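{- For any $\epsilon$ and $n$ with $\frac{2}{3}\le\epsilon\le 1$ and $n>2^{56/\epsilon^2}$, if $C$ is a rigid symmetric circuit over a universe $U$ with $|U|=n$ and $$s:=\max_{g\in C}|\mathrm{Orb}(g)|\le 2^{n^{1-\epsilon}},$$ then $$\mathsf{SP}(C)\le\frac{33}{\epsilon}\cdot\frac{\log s}{\log n}.$$
   Context: Logarithms are to base $2$. $\mathrm{Sym}_U$ is the group of permutations of the finite set $U$. Circuits. A Boolean basis $\mathbb{B}$ is a finite set of Boolean functions $\{0,1\}^*\to\{0,1\}$, each symmetric (its value depends only on the input length and the number of ones). A relational vocabulary $\tau$ is a finite sequence of relation symbols with arities. A $(\mathbb{B},\tau)$-circuit $C$ with (finite) universe $U$ computing a $q$-ary query is a tuple $\langle G,W,\Omega,\Sigma,\Lambda\rangle$ where: $G$ is a finite set of gates; $W\subseteq G\times G$ (wires) makes $(G,W)$ a directed acyclic graph, gates without incoming wires being input gates, the others internal gates, and $h$ is a child of $g$ if $(h,g)\in W$; $\Omega:U^q\to G$ is injective (its image is the set of output gates; for $q=0$ there is a single output gate); $\Sigma:G\to\mathbb{B}\uplus\tau\uplus\{0,1\}$ maps input gates into $\tau\uplus\{0,1\}$ with $|\Sigma^{ -1}(0)|,|\Sigma^{ -1}(1)|\le1$, and internal gates into $\mathbb{B}$; input gates $g$ with $\Sigma(g)\in\tau$ are relational gates; $\Lambda=(\Lambda_R)_{R\in\tau}$, where $\Lambda_R$ is an injective function mapping each relational gate $g$ with $\Sigma(g)=R$ to a tuple $\Lambda_R(g)=\Lambda(g)\in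 U^r$, $r$ the arity of $R$. "Circuit" in the claim means such a circuit for arbitrary $\mathbb{B},\tau,q$. Symmetry and rigidity. $\sigma\in\mathrm{Sym}_U$ induces the automorphism $\pi$ of $C$ if $\pi:G\to G$ is a bijection such that $W(g,h)$ iff $W(\pi(g),\pi(h))$ for all gates; $\pi\Omega(x)=\Omega(\sigma x)$ for all $x\in U^q$; $\Sigma(g)=\Sigma(\pi(g))$ for all gates; and $\sigma\Lambda(g)=\Lambda(\pi(g))$ for all relational gates. $C$ is symmetric if every $\sigma\in\mathrm{Sym}_U$ induces an automorphism of $C$. $C$ is rigid if there do not exist distinct gates $g,g'$ with $\Sigma(g)=\Sigma(g')$, $\Lambda(g)=\Lambda(g')$ (vacuous for non-relational gates), $\Omega^{ -1}(g)=\Omega^{ -1}(g')$, and the same set of children. For a rigid symmetric circuit the automorphism induced by each $\sigma$ is unique, and $\sigma g$ denotes the image of $g$ under it. $\mathrm{Orb}(g)=\{\sigma g:\sigma\in\mathrm{Sym}_U\}$ is the orbit of $g$ and $\mathrm{Stab}_U(g)=\{\sigma\in\mathrm{Sym}_U:\sigma g=g\}$. Supports. For a partition $\mathcal{P}$ of $U$, $\mathrm{Stab}_U(\mathcal{P})=\{\sigma\in\mathrm{Sym}_U:\sigma P=P\ \forall P\in\mathcal{P}\}$. $\mathcal{P}$ is a supporting partition of a group $H\subseteq\mathrm{Sym}_U$ if $\mathrm{Stab}_U(\mathcal{P})\subseteq H$. A partition $\mathcal{P}'$ is as coarse as $\mathcal{P}$ if every part of $\mathcal{P}$ is contained in a part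 of $\mathcal{P}'$. Every permutation group $H\subseteq\mathrm{Sym}_U$ has a unique coarsest supporting partition, denoted $\mathsf{SP}(H)$; for a gate $g$ write $\mathsf{SP}(g)=\mathsf{SP}(\mathrm{Stab}_U(g))$. Let $\|\mathsf{SP}(g)\|$ be the smallest value of $|U\setminus P|$ over parts $P\in\mathsf{SP}(g)$, and $\mathsf{SP}(C)=\max_g\|\mathsf{SP}(g)\|$ over all gates $g$ of $C$. -}

module Defs where

open import Data.Bool.Base using (Bool)
open import Data.Empty using (⊥-elim)
open import Data.Fin.Base using (Fin)
open import Data.Fin.Permutation using (Permutation′; _⟨$⟩ʳ_; _⟨$⟩ˡ_)
import Data.Fin.Permutation as Perm
open import Data.Fin.Subset using (Subset; Nonempty; ⁅_⁆; _∈_; _⊆_; ∁; ∣_∣)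
import Data.Fin.Subset.Properties as Subset
open import Data.Integer.Base as ℤ using (ℤ; +_; -[1+_]; +0; _⊖_)
import Data.Integer.Properties as ℤ
open import Data.List.Base using (List; length; filterᵇ)
open import Data.Nat.Base as ℕ using (ℕ; zero; suc; NonZero)
import Data.Nat.Properties as ℕ
open import Data.Product using (∃-syntax; _×_; _,_; proj₁)
open import Data.Rational.Base as ℚ using (ℚ; 0ℚ; 1ℚ)
import Data.Rational.Properties as ℚ
import Data.Rational.Unnormalised.Base as ℚᵘ
import Data.Rational.Unnormalised.Properties as ℚᵘ
open import Data.Sum.Base using (_⊎_; inj₁; inj₂)
open import Data.Vec.Base using (Vec; map; tabulate; lookup)
open import Function.Base using (id; _∘_)
open import Function.Bundles using (_⇔_; Equivalence)
open import Level using (0ℓ)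
open import Relation.Binary.Core using (Rel)
open import Relation.Binary.Construct.Closure.Transitive using (TransClosure)
open import Relation.Binary.Definitions using (Decidable; tri<; tri≈; tri>)
open import Relation.Binary.PropositionalEquality
  using (_≡_; _≢_; refl; sym; trans; cong; subst; subst₂)
open import Relation.Nullary using (¬_)

private
  variable
    m n : ℕ

private
  <⇒≱ : ∀ {p q} → p ℚ.< q → ¬ (q ℚ.≤ p)
  <⇒≱ p<q q≤p = ℚ.<-irrefl refl (ℚ.<-≤-trans p<q q≤p)

  frac-≤ : ∀ i c j d → i ℤ.* + suc d ℤ.≤ j ℤ.* + suc c →
           i ℚ./ suc c ℚ.≤ j ℚ./ suc d
  frac-≤ i c j d h = ℚ.toℚᵘ-cancel-≤
    (ℚᵘ.≤-trans (ℚᵘ.≤-reflexive (ℚ.toℚᵘ-fromℚᵘ (ℚᵘ.mkℚᵘ i c)))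
    (ℚᵘ.≤-trans (ℚᵘ.*≤* h)
                (ℚᵘ.≤-reflexive (ℚᵘ.≃-sym (ℚ.toℚᵘ-fromℚᵘ (ℚᵘ.mkℚᵘ j d))))))

  frac-< : ∀ i c j d → i ℚ./ suc c ℚ.< j ℚ./ suc d →
           i ℤ.* + suc d ℤ.< j ℤ.* + suc c
  frac-< i c j d h = ℚᵘ.drop-*<*
    (ℚᵘ.≤-<-trans (ℚᵘ.≤-reflexive (ℚᵘ.≃-sym (ℚ.toℚᵘ-fromℚᵘ (ℚᵘ.mkℚᵘ i c))))
    (ℚᵘ.<-≤-trans (ℚ.toℚᵘ-mono-< h)
                  (ℚᵘ.≤-reflexive (ℚ.toℚᵘ-fromℚᵘ (ℚᵘ.mkℚᵘ j d)))))

  fracℕ-< : ∀ a c b d → + a ℚ./ suc c ℚ.< + b ℚ./ suc d →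
            a ℕ.* suc d ℕ.< b ℕ.* suc c
  fracℕ-< a c b d h = ℤ.drop‿+<+
    (subst₂ ℤ._<_ (sym (ℤ.pos-* a (suc d))) (sym (ℤ.pos-* b (suc c)))
      (frac-< (+ a) c (+ b) d h))

  archimedean : ∀ q → ∃[ k ] q ℚ.≤ + k ℚ./ 1
  archimedean q@(ℚ.mkℚ i d _) = ℤ.∣ i ∣ ,
    subst (ℚ._≤ _) (ℚ.↥p/↧p≡p q) (frac-≤ i d (+ ℤ.∣ i ∣) 0 (lemma i))
    where
    lemma : ∀ j → j ℤ.* + 1 ℤ.≤ + ℤ.∣ j ∣ ℤ.* + suc d
    lemma (+ k)    = subst₂ ℤ._≤_ (ℤ.pos-* k 1) (ℤ.pos-* k (suc d))
                       (ℤ.+≤+ (ℕ.*-monoʳ-≤ k {1} {suc d} (ℕ.s≤s ℕ.z≤n)))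
    lemma -[1+ k ] = ℤ.-≤+

  below : ∀ q → ∃[ p ] p ℚ.< q
  below q = q ℚ.+ ℚ.- 1ℚ ,
    subst (q ℚ.+ ℚ.- 1ℚ ℚ.<_) (ℚ.+-identityʳ q)
      (ℚ.+-monoʳ-< q (ℚ.negative⁻¹ (ℚ.- 1ℚ)))

  +-cancel : ∀ p r → (p ℚ.+ ℚ.- r) ℚ.+ r ≡ p
  +-cancel p r = trans (ℚ.+-assoc p (ℚ.- r) r)
    (trans (cong (p ℚ.+_) (ℚ.+-inverseˡ r)) (ℚ.+-identityʳ p))

  -+-cancel : ∀ p r → (p ℚ.+ r) ℚ.+ ℚ.- r ≡ p
  -+-cancel p r = trans (ℚ.+-assoc p r (ℚ.- r))
    (trans (cong (p ℚ.+_) (ℚ.+-inverseʳ r)) (ℚ.+-identityʳ p))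

  *-mono : ∀ {a b c d} → 0ℚ ℚ.≤ b → 0ℚ ℚ.≤ c → a ℚ.≤ c → b ℚ.≤ d →
           a ℚ.* b ℚ.≤ c ℚ.* d
  *-mono {a} {b} {c} {d} 0≤b 0≤c a≤c b≤d = ℚ.≤-trans
    (ℚ.*-monoʳ-≤-nonNeg b {{ℚ.nonNegative 0≤b}} a≤c)
    (ℚ.*-monoˡ-≤-nonNeg c {{ℚ.nonNegative 0≤c}} b≤d)

  *-positive : ∀ {a b} → 0ℚ ℚ.< a → 0ℚ ℚ.< b → 0ℚ ℚ.< a ℚ.* b
  *-positive {a} {b} 0<a 0<b = subst (ℚ._< a ℚ.* b) (ℚ.*-zeroˡ b)
    (ℚ.*-monoˡ-<-pos b {{ℚ.positive 0<b}} 0<a)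

  reciprocal : ∀ {q} → 0ℚ ℚ.< q → ∃[ r ] 0ℚ ℚ.< r × r ℚ.* q ≡ 1ℚ
  reciprocal {q} 0<q = (ℚ.1/ q) , ℚ.positive⁻¹ (ℚ.1/ q) {{ℚ.1/pos⇒pos q}} , ℚ.*-inverseˡ q
    where instance
      _ = ℚ.positive 0<q
      _ = ℚ.pos⇒nonZero q

  upper : ∀ b a d N c {u v} → .{{NonZero b}} → a ℕ.≤ N ℕ.* suc c ℕ.+ d →
          b ℕ.^ N ℕ.* v ℕ.< u →
          ¬ (u ℕ.^ suc c ℕ.* b ℕ.^ d ℕ.≤ b ℕ.^ a ℕ.* v ℕ.^ suc c)
  upper b a d N c {u} {v} a≤ v<u = ℕ.<⇒≱ (begin-strict
    b ℕ.^ a ℕ.* v ℕ.^ k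
      ≤⟨ ℕ.*-monoˡ-≤ (v ℕ.^ k) (ℕ.^-monoʳ-≤ b a≤) ⟩
    b ℕ.^ (N ℕ.* k ℕ.+ d) ℕ.* v ℕ.^ k
      ≡⟨ cong (ℕ._* v ℕ.^ k) (ℕ.^-distribˡ-+-* b (N ℕ.* k) d) ⟩
    b ℕ.^ (N ℕ.* k) ℕ.* b ℕ.^ d ℕ.* v ℕ.^ k
      ≡⟨ cong (λ z → z ℕ.* b ℕ.^ d ℕ.* v ℕ.^ k) (sym (ℕ.^-*-assoc b N k)) ⟩
    (b ℕ.^ N) ℕ.^ k ℕ.* b ℕ.^ d ℕ.* v ℕ.^ k
      ≡⟨ ℕ.*-assoc ((b ℕ.^ N) ℕ.^ k) _ _ ⟩
    (b ℕ.^ N) ℕ.^ k ℕ.* (b ℕ.^ d ℕ.* v ℕ.^ k)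
      ≡⟨ cong ((b ℕ.^ N) ℕ.^ k ℕ.*_) (ℕ.*-comm (b ℕ.^ d) _) ⟩
    (b ℕ.^ N) ℕ.^ k ℕ.* (v ℕ.^ k ℕ.* b ℕ.^ d)
      ≡⟨ sym (ℕ.*-assoc ((b ℕ.^ N) ℕ.^ k) _ _) ⟩
    (b ℕ.^ N) ℕ.^ k ℕ.* v ℕ.^ k ℕ.* b ℕ.^ d
      ≡⟨ cong (ℕ._* b ℕ.^ d) (sym (distrib (b ℕ.^ N) v k)) ⟩
    (b ℕ.^ N ℕ.* v) ℕ.^ k ℕ.* b ℕ.^ d
      <⟨ ℕ.*-monoˡ-< (b ℕ.^ d) {{ℕ.m^n≢0 b d}} (ℕ.^-monoˡ-< k v<u) ⟩
    u ℕ.^ k ℕ.* b ℕ.^ d ∎)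
    where
    open ℕ.≤-Reasoning
    k = suc c
    distrib : ∀ x y j → (x ℕ.* y) ℕ.^ j ≡ x ℕ.^ j ℕ.* y ℕ.^ j
    distrib x y zero    = refl
    distrib x y (suc j) = trans (cong (x ℕ.* y ℕ.*_) (distrib x y j))
                                (ℕ.[m*n]*[o*p]≡[m*o]*[n*p] x y _ _)

  n<2^n : ∀ k → k ℕ.< 2 ℕ.^ k
  n<2^n zero    = ℕ.s≤s ℕ.z≤n
  n<2^n (suc k) = ℕ.≤-trans (ℕ.+-mono-≤ (ℕ.m^n>0 2 k) (n<2^n k))
    (ℕ.≤-reflexive (cong (2 ℕ.^ k ℕ.+_) (sym (ℕ.+-identityʳ _))))

-- Dedekind cuts in their one-sided form: a proper nonempty lower set of
-- rationals without a greatest element.  As in the classical development,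
-- locatedness is not demanded: excluded middle makes every such cut located,
-- and what is proved for all cuts holds for the located ones.

record ℝ : Set₁ where
  field
    cut       : ℚ → Set
    inhabited : ∃[ q ] cut q
    bounded   : ∃[ q ] ¬ cut q
    lower     : ∀ {p q} → p ℚ.< q → cut q → cut p
    open-cut  : ∀ {p} → cut p → ∃[ q ] p ℚ.< q × cut q

open ℝ public

infix 4 _≤_ _<_

_≤_ : ℝ → ℝ → Set
x ≤ y = ∀ q → cut x q → cut y q

_<_ : ℝ → ℝ → Set
x < y = ∃[ q ] cut y q × ¬ cut x q

fromℚ : ℚ → ℝ
fromℚ q = record
  { cut       = ℚ._< q
  ; inhabited = below q
  ; bounded   = q , ℚ.<-irrefl refl
  ; lower     = ℚ.<-trans
  ; open-cut  = ℚ.<-dense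
  }

fromℕ : ℕ → ℝ
fromℕ k = fromℚ (+ k ℚ./ 1)

0ℝ : ℝ
0ℝ = fromℚ 0ℚ

private
  below-bound : ∀ x {p q} → ¬ cut x q → cut x p → p ℚ.< q
  below-bound x {p} {q} ¬xq xp with ℚ.<-cmp p q
  ... | tri< p<q _ _  = p<q
  ... | tri≈ _ refl _ = ⊥-elim (¬xq xp)
  ... | tri> _ _ q<p  = ⊥-elim (¬xq (lower x q<p xp))

  bound-mono : ∀ x {q r} → q ℚ.≤ r → ¬ cut x q → ¬ cut x r
  bound-mono x q≤r ¬xq xr = <⇒≱ (below-bound x ¬xq xr) q≤r

  natBound : ∀ x → ∃[ k ] ¬ cut x (+ k ℚ./ 1)
  natBound x with bounded x
  ... | q , ¬xq with archimedean q
  ...   | k , q≤k = k , bound-mono x q≤k ¬xq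

  nonNegBound : ∀ k → 0ℚ ℚ.≤ + k ℚ./ 1
  nonNegBound k = frac-≤ +0 0 (+ k) 0
    (subst (+0 ℤ.≤_) (ℤ.pos-* k 1) (ℤ.+≤+ ℕ.z≤n))

  positivePoint : ∀ {x} → 0ℝ < x → ∃[ q ] 0ℚ ℚ.< q × cut x q
  positivePoint {x} (q , xq , q≮0) with open-cut x xq
  ... | r , q<r , xr = r , ℚ.≤-<-trans (ℚ.≮⇒≥ q≮0) q<r , xr

  zero-cut : ∀ {x} → cut x 0ℚ → 0ℝ < x
  zero-cut x0 = 0ℚ , x0 , ℚ.<-irrefl refl

infixl 6 _-_

_-_ : ℝ → ℝ → ℝ
x - y = record
  { cut       = λ p → ∃[ q ] ∃[ r ] cut x q × ¬ cut y r × p ℚ.+ r ℚ.< q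
  ; inhabited =
      let q , xq = inhabited x
          r , ¬yr = bounded y
          p , p<q = below q
      in p ℚ.+ ℚ.- r , q , r , xq , ¬yr , subst (ℚ._< q) (sym (+-cancel p r)) p<q
  ; bounded   =
      let q , ¬xq = bounded x
          r , yr = inhabited y
      in q ℚ.+ ℚ.- r , λ (q′ , r′ , xq′ , ¬yr′ , lt) →
        ℚ.<-asym (ℚ.<-trans lt (below-bound x ¬xq xq′))
          (subst (ℚ._< q ℚ.+ ℚ.- r ℚ.+ r′) (+-cancel q r)
            (ℚ.+-monoʳ-< (q ℚ.+ ℚ.- r) (below-bound y ¬yr′ yr)))
  ; lower     = λ p<p′ (q , r , xq , ¬yr , lt) →
      q , r , xq , ¬yr , ℚ.<-trans (ℚ.+-monoˡ-< r p<p′) lt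
  ; open-cut  = λ {p} (q , r , xq , ¬yr , lt) →
      let t , p+r<t , t<q = ℚ.<-dense lt
      in t ℚ.+ ℚ.- r ,
         subst (ℚ._< t ℚ.+ ℚ.- r) (-+-cancel p r) (ℚ.+-monoˡ-< (ℚ.- r) p+r<t) ,
         q , r , xq , ¬yr , subst (ℚ._< q) (sym (+-cancel t r)) t<q
  }

infixl 7 _*_ _/_[_]

-- The product of nonnegative reals; it is applied to such arguments only.
_*_ : ℝ → ℝ → ℝ
x * y = record
  { cut       = λ p → p ℚ.< 0ℚ ⊎
                  (∃[ q ] ∃[ r ] 0ℚ ℚ.≤ q × 0ℚ ℚ.≤ r × cut x q × cut y r × p ℚ.< q ℚ.* r)
  ; inhabited = let p , p<0 = below 0ℚ in p , inj₁ p<0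
  ; bounded   =
      let j , ¬xj = natBound x
          k , ¬yk = natBound y
          0≤j = nonNegBound j
          0≤k = nonNegBound k
      in (+ j ℚ./ 1) ℚ.* (+ k ℚ./ 1) , λ where
        (inj₁ jk<0) → <⇒≱ jk<0
          (subst (ℚ._≤ (+ j ℚ./ 1) ℚ.* (+ k ℚ./ 1)) (ℚ.*-zeroˡ 0ℚ)
            (*-mono ℚ.≤-refl 0≤j 0≤j 0≤k))
        (inj₂ (q , r , 0≤q , 0≤r , xq , yr , lt)) → <⇒≱ lt
          (*-mono 0≤r 0≤j (ℚ.<⇒≤ (below-bound x ¬xj xq)) (ℚ.<⇒≤ (below-bound y ¬yk yr)))
  ; lower     = λ where
      p<p′ (inj₁ p′<0) → inj₁ (ℚ.<-trans p<p′ p′<0)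
      p<p′ (inj₂ (q , r , 0≤q , 0≤r , xq , yr , lt)) →
        inj₂ (q , r , 0≤q , 0≤r , xq , yr , ℚ.<-trans p<p′ lt)
  ; open-cut  = λ where
      (inj₁ p<0) → let t , p<t , t<0 = ℚ.<-dense p<0 in t , p<t , inj₁ t<0
      (inj₂ (q , r , 0≤q , 0≤r , xq , yr , lt)) →
        let t , p<t , t<qr = ℚ.<-dense lt
        in t , p<t , inj₂ (q , r , 0≤q , 0≤r , xq , yr , t<qr)
  }

private
  positiveBound : ∀ {y} → 0ℝ < y → ∃[ r ] 0ℚ ℚ.< r × ¬ cut y r
  positiveBound {y} 0<y =
    let q , 0<q , yq = positivePoint {y} 0<y
        r , ¬yr      = bounded y
    in r , ℚ.<-trans 0<q (below-bound y ¬yr yq) , ¬yr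

  inverse-zero : ∀ {y} → 0ℝ < y → ∃[ r ] ∃[ p′ ]
    0ℚ ℚ.< r × ¬ cut y r × 0ℚ ℚ.< p′ × p′ ℚ.* r ℚ.≤ 1ℚ
  inverse-zero {y} 0<y =
    let r , 0<r , ¬yr = positiveBound {y} 0<y
        s , 0<s , sr≡1 = reciprocal 0<r
    in r , s , 0<r , ¬yr , 0<s , ℚ.≤-reflexive sr≡1

-- p < 1/y exactly when p < p′ ≤ 1/r for some rational r ≥ y.
inverse : (y : ℝ) → 0ℝ < y → ℝ
inverse y 0<y = record
  { cut       = λ p → ∃[ r ] ∃[ p′ ] 0ℚ ℚ.< r × ¬ cut y r × p ℚ.< p′ × p′ ℚ.* r ℚ.≤ 1ℚ
  ; inhabited = 0ℚ , inverse-zero {y} 0<y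
  ; bounded   =
      let q , 0<q , yq = positivePoint {y} 0<y
          s , 0<s , sq≡1 = reciprocal 0<q
      in s , λ (r , p′ , 0<r , ¬yr , s<p′ , p′r≤1) →
        <⇒≱ (ℚ.<-≤-trans
          (subst (ℚ._< p′ ℚ.* q) sq≡1 (ℚ.*-monoˡ-<-pos q {{ℚ.positive 0<q}} s<p′))
          (ℚ.*-monoˡ-≤-nonNeg p′ {{ℚ.nonNegative (ℚ.<⇒≤ (ℚ.<-trans 0<s s<p′))}}
            (ℚ.<⇒≤ (below-bound y ¬yr yq))))
          p′r≤1
  ; lower     = λ p<q (r , p′ , 0<r , ¬yr , q<p′ , le) →
      r , p′ , 0<r , ¬yr , ℚ.<-trans p<q q<p′ , le
  ; open-cut  = λ (r , p′ , 0<r , ¬yr , p<p′ , le) →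
      let t , p<t , t<p′ = ℚ.<-dense p<p′
      in t , p<t , r , p′ , 0<r , ¬yr , t<p′ , le
  }

-- x / y [ 0<y ], for nonnegative x.
_/_[_] : (x y : ℝ) → 0ℝ < y → ℝ
x / y [ 0<y ] = x * inverse y 0<y

infixr 8 _^_

-- b ^ x is the supremum of the rationals u / v with u / v ≤ b ^ e for some
-- rational e = (a - d) / c in x; here v and c are successors.  Since b ≥ 1,
-- the powers b ^ e increase with e.
_^_ : (b : ℕ) → .{{NonZero b}} → ℝ → ℝ
b ^ x = record
  { cut       = λ p → ∃[ a ] ∃[ d ] ∃[ c ] ∃[ u ] ∃[ v ]
                  cut x ((a ⊖ d) ℚ./ suc c) × p ℚ.< + u ℚ./ suc v ×
                  u ℕ.^ suc c ℕ.* b ℕ.^ d ℕ.≤ b ℕ.^ a ℕ.* suc v ℕ.^ suc c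
  ; inhabited =
      let e , xe = inhabited x
          p , p<0 = below (+ 0 ℚ./ 1)
      in p , split e xe p<0
  ; bounded   =
      let k , ¬xk = natBound x
      in + (b ℕ.^ k) ℚ./ 1 , λ (a , d , c , u , v , xe , p<u/v , le) →
        upper b a d k c
          (ℕ.≮⇒≥ λ lt → bound-mono x (exponent a d k c lt) ¬xk xe)
          (subst (b ℕ.^ k ℕ.* suc v ℕ.<_) (ℕ.*-identityʳ u)
            (fracℕ-< (b ℕ.^ k) 0 u v p<u/v))
          le
  ; lower     = λ p<q (a , d , c , u , v , xe , q<u/v , le) →
      a , d , c , u , v , xe , ℚ.<-trans p<q q<u/v , le
  ; open-cut  = λ (a , d , c , u , v , xe , p<u/v , le) →
      let t , p<t , t<u/v = ℚ.<-dense p<u/v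
      in t , p<t , a , d , c , u , v , xe , t<u/v , le
  }
  where
  split : ∀ e → cut x e → ∀ {p} → p ℚ.< + 0 ℚ./ 1 → ∃[ a ] ∃[ d ] ∃[ c ] ∃[ u ] ∃[ v ]
            cut x ((a ⊖ d) ℚ./ suc c) × p ℚ.< + u ℚ./ suc v ×
            u ℕ.^ suc c ℕ.* b ℕ.^ d ℕ.≤ b ℕ.^ a ℕ.* suc v ℕ.^ suc c
  split e@(ℚ.mkℚ (+ a) c _) xe p<0 =
    a , 0 , c , 0 , 0 , subst (cut x) (sym (ℚ.↥p/↧p≡p e)) xe , p<0 , ℕ.z≤n
  split e@(ℚ.mkℚ -[1+ d ] c _) xe p<0 =
    0 , suc d , c , 0 , 0 , subst (cut x) (sym (ℚ.↥p/↧p≡p e)) xe , p<0 , ℕ.z≤n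

  exponent : ∀ a d k c → k ℕ.* suc c ℕ.+ d ℕ.< a →
             + k ℚ./ 1 ℚ.≤ (a ⊖ d) ℚ./ suc c
  exponent a d k c lt = frac-≤ (+ k) 0 (a ⊖ d) c
    (subst₂ ℤ._≤_ (ℤ.pos-* k (suc c)) (sym (ℤ.*-identityʳ (a ⊖ d)))
      (subst (ℤ._≤ a ⊖ d)
        (trans (ℤ.⊖-≥ (ℕ.m≤n+m d (k ℕ.* suc c))) (cong +_ (ℕ.m+n∸n≡m (k ℕ.* suc c) d)))
        (ℤ.⊖-monoˡ-≤ d (ℕ.<⇒≤ lt))))

-- The binary logarithm of k ≥ 1: the supremum of the rationals a / c ≥ 0
-- with 2 ^ (a / c) ≤ k; here c is a successor.
log : (k : ℕ) → .{{NonZero k}} → ℝ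
log k = record
  { cut       = λ p → ∃[ a ] ∃[ c ] p ℚ.< + a ℚ./ suc c × 2 ℕ.^ a ℕ.≤ k ℕ.^ suc c
  ; inhabited =
      let p , p<0 = below (+ 0 ℚ./ 1)
      in p , 0 , 0 , p<0 , ℕ.m^n>0 k 1
  ; bounded   = + k ℚ./ 1 , λ (a , c , k<a/c , le) → ℕ.<⇒≱ (begin-strict
      k ℕ.^ suc c            <⟨ ℕ.^-monoˡ-< (suc c) (n<2^n k) ⟩
      (2 ℕ.^ k) ℕ.^ suc c    ≡⟨ ℕ.^-*-assoc 2 k (suc c) ⟩
      2 ℕ.^ (k ℕ.* suc c)    ≤⟨ ℕ.^-monoʳ-≤ 2 (ℕ.<⇒≤ (fracℕ-< k 0 a c k<a/c)) ⟩
      2 ℕ.^ (a ℕ.* 1)        ≡⟨ cong (2 ℕ.^_) (ℕ.*-identityʳ a) ⟩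
      2 ℕ.^ a                ∎) le
  ; lower     = λ p<q (a , c , q<a/c , le) → a , c , ℚ.<-trans p<q q<a/c , le
  ; open-cut  = λ (a , c , p<a/c , le) →
      let t , p<t , t<a/c = ℚ.<-dense p<a/c
      in t , p<t , a , c , t<a/c , le
  }
  where open ℕ.≤-Reasoning

⅔ : ℝ
⅔ = fromℚ (+ 2 ℚ./ 3)

⅔≤⇒positive : ∀ {x} → ⅔ ≤ x → 0ℝ < x
⅔≤⇒positive {x} ⅔≤x = zero-cut {x} (⅔≤x 0ℚ (ℚ.positive⁻¹ (+ 2 ℚ./ 3)))

*-pos : ∀ {x y} → 0ℝ < x → 0ℝ < y → 0ℝ < x * y
*-pos {x} {y} 0<x 0<y =
  let q , 0<q , xq = positivePoint {x} 0<x
      r , 0<r , yr = positivePoint {y} 0<y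
  in zero-cut {x * y}
       (inj₂ (q , r , ℚ.<⇒≤ 0<q , ℚ.<⇒≤ 0<r , xq , yr , *-positive 0<q 0<r))

/-pos : ∀ {x y} → 0ℝ < x → (0<y : 0ℝ < y) → 0ℝ < x / y [ 0<y ]
/-pos {x} {y} 0<x 0<y = *-pos {x} {inverse y 0<y} 0<x
  (zero-cut {inverse y 0<y} (inverse-zero {y} 0<y))

fromℕ-pos : ∀ k → .{{NonZero k}} → 0ℝ < fromℕ k
fromℕ-pos (suc k) = zero-cut {fromℕ (suc k)}
  (ℚ.positive⁻¹ (+ suc k ℚ./ 1) {{ℚ.normalize-pos (suc k) 1}})

2^<⇒1< : ∀ {x} → 0ℝ < x → 2 ^ x < fromℕ n → 1 ℕ.< n
2^<⇒1< {n} {x} 0<x (q , q<n , ¬q) = ℕ.≰⇒> λ n≤1 → ¬q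
  ( 0 , 0 , 0 , 1 , 0
  , lower′
  , ℚ.<-≤-trans q<n (frac-≤ (+ n) 0 (+ 1) 0
      (subst₂ ℤ._≤_ (ℤ.pos-* n 1) refl
        (ℤ.+≤+ (ℕ.≤-trans (ℕ.≤-reflexive (ℕ.*-identityʳ n)) n≤1))))
  , ℕ.≤-refl )
  where
  lower′ : cut x 0ℚ
  lower′ = let q , 0<q , xq = positivePoint {x} 0<x in lower x 0<q xq

log-pos : .{{_ : NonZero n}} → 1 ℕ.< n → 0ℝ < log n
log-pos {n} 1<n = zero-cut {log n}
  (1 , 0 , ℚ.positive⁻¹ 1ℚ , ℕ.≤-trans 1<n (ℕ.≤-reflexive (sym (ℕ.*-identityʳ n))))

ones : List Bool → ℕ
ones = length ∘ filterᵇ id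

record Basis : Set where
  field
    size      : ℕ
    function  : Fin size → List Bool → Bool
    symmetric : ∀ i xs ys → length xs ≡ length ys → ones xs ≡ ones ys →
                function i xs ≡ function i ys
    -- The basis is a set of functions, and rigidity compares labels: no
    -- function may occur under two indices.
    distinct  : ∀ i j → (∀ xs → function i xs ≡ function j xs) → i ≡ j

record Vocabulary : Set where
  field
    size  : ℕ
    arity : Fin size → ℕ

data Label (𝔹 : Basis) (τ : Vocabulary) : Set where
  op    : Fin (Basis.size 𝔹) → Label 𝔹 τ
  rel   : Fin (Vocabulary.size τ) → Label 𝔹 τ
  const : Bool → Label 𝔹 τ

record Circuit (𝔹 : Basis) (τ : Vocabulary) (q n : ℕ) : Set₁ where
  open Vocabulary τ using (arity)
  field
    gates : ℕ

  Gate : Set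
  Gate = Fin gates

  field
    Wire    : Rel Gate 0ℓ
    wire?   : Decidable Wire
    acyclic : ∀ g → ¬ TransClosure Wire g g

  IsInput : Gate → Set
  IsInput g = ∀ h → ¬ Wire h g

  field
    Ω           : Vec (Fin n) q → Gate
    Ω-injective : ∀ x y → Ω x ≡ Ω y → x ≡ y

    label          : Gate → Label 𝔹 τ
    input-label    : ∀ g → IsInput g → ∀ i → label g ≢ op i
    internal-label : ∀ g → ¬ IsInput g → ∃[ i ] label g ≡ op i
    const-unique   : ∀ b g h → label g ≡ const b → label h ≡ const b → g ≡ h

    Λ           : ∀ R g → label g ≡ rel R → Vec (Fin n) (arity R)
    Λ-injective : ∀ R g h (eg : label g ≡ rel R) (eh : label h ≡ rel R) →
                  Λ R g eg ≡ Λ R h eh → g ≡ h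

_·_ : ∀ {k} → Permutation′ n → Vec (Fin n) k → Vec (Fin n) k
σ · x = map (σ ⟨$⟩ʳ_) x

module _ {𝔹 : Basis} {τ : Vocabulary} {q n : ℕ} (C : Circuit 𝔹 τ q n) where
  open Circuit C

  record Induces (σ : Permutation′ n) (π : Permutation′ gates) : Set where
    field
      wires     : ∀ g h → Wire g h ⇔ Wire (π ⟨$⟩ʳ g) (π ⟨$⟩ʳ h)
      outputs   : ∀ x → π ⟨$⟩ʳ Ω x ≡ Ω (σ · x)
      labels    : ∀ g → label g ≡ label (π ⟨$⟩ʳ g)
      relations : ∀ R g (e : label g ≡ rel R) (e′ : label (π ⟨$⟩ʳ g) ≡ rel R) →
                  σ · Λ R g e ≡ Λ R (π ⟨$⟩ʳ g) e′

  Symmetric : Set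
  Symmetric = ∀ σ → ∃[ π ] Induces σ π

  record Twins (g h : Gate) : Set where
    field
      same-label    : label g ≡ label h
      same-tuple    : ∀ R (eg : label g ≡ rel R) (eh : label h ≡ rel R) →
                      Λ R g eg ≡ Λ R h eh
      same-outputs  : ∀ x → Ω x ≡ g ⇔ Ω x ≡ h
      same-children : ∀ k → Wire k g ⇔ Wire k h

  Rigid : Set
  Rigid = ¬ (∃[ g ] ∃[ h ] g ≢ h × Twins g h)

  -- The automorphism is unique when C is rigid, so that σ g does not then
  -- depend on the choice made by the proof of symmetry.
  act : Symmetric → Permutation′ n → Gate → Gate
  act sym-C σ g = proj₁ (sym-C σ) ⟨$⟩ʳ g

  Orb : Symmetric → Gate → Gate → Set
  Orb sym-C g h = ∃[ σ ] act sym-C σ g ≡ h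

  Stab : Symmetric → Gate → Permutation′ n → Set
  Stab sym-C g σ = act sym-C σ g ≡ g

HasSize : (Fin m → Set) → ℕ → Set
HasSize P k = ∃[ S ] (∀ h → h ∈ S ⇔ P h) × ∣ S ∣ ≡ k

-- F relates each a to its value; m is the largest of these values.
IsMaximum : {A : Set} → (A → ℕ → Set) → ℕ → Set
IsMaximum F m = (∀ a → ∃[ k ] F a k × k ℕ.≤ m) × (∃[ a ] F a m)

IsMinimum : {A : Set} → (A → ℕ) → ℕ → Set
IsMinimum f m = (∀ a → m ℕ.≤ f a) × (∃[ a ] f a ≡ m)

MaxOrbit : ∀ {𝔹 τ q} (C : Circuit 𝔹 τ q n) → Symmetric C → ℕ → Set
MaxOrbit C sym-C = IsMaximum (λ g → HasSize (Orb C sym-C g))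

MaxOrbit-nonZero : ∀ {𝔹 τ q} (C : Circuit 𝔹 τ q n) (sym-C : Symmetric C) {s} →
                   MaxOrbit C sym-C s → NonZero s
MaxOrbit-nonZero C sym-C (_ , g , S , S⇔Orb , refl) = ℕ.>-nonZero
  (subst (ℕ._≤ ∣ S ∣) (Subset.∣⁅x⁆∣≡1 h) (Subset.p⊆q⇒∣p∣≤∣q∣ ⁅h⁆⊆S))
  where
  h = act C sym-C Perm.id g
  h∈S : h ∈ S
  h∈S = Equivalence.from (S⇔Orb h) (Perm.id , refl)
  ⁅h⁆⊆S : ⁅ h ⁆ ⊆ S
  ⁅h⁆⊆S x∈ = subst (_∈ S) (sym (Subset.x∈⁅y⁆⇒x≡y h x∈)) h∈S

record Partition (n : ℕ) : Set where
  field
    parts    : ℕ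
    part     : Fin parts → Subset n
    nonempty : ∀ i → Nonempty (part i)
    covering : ∀ u → ∃[ i ] u ∈ part i
    disjoint : ∀ i j u → u ∈ part i → u ∈ part j → i ≡ j

open Partition public

image : Permutation′ n → Subset n → Subset n
image σ S = tabulate (λ u → lookup S (σ ⟨$⟩ˡ u))

PartitionStab : Partition n → Permutation′ n → Set
PartitionStab P σ = ∀ i → image σ (part P i) ≡ part P i

Supports : Partition n → (Permutation′ n → Set) → Set
Supports P H = ∀ σ → PartitionStab P σ → H σ

AsCoarseAs : Partition n → Partition n → Set
AsCoarseAs P′ P = ∀ i → ∃[ j ] part P i ⊆ part P′ j

IsSP : (Permutation′ n → Set) → Partition n → Set
IsSP H P = Supports P H × (∀ Q → Supports Q H → AsCoarseAs P Q)

‖_‖≡_ : Partition n → ℕ → Set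
‖ P ‖≡ k = IsMinimum (λ i → ∣ ∁ (part P i) ∣) k

CircuitSP : ∀ {𝔹 τ q} (C : Circuit 𝔹 τ q n) → Symmetric C → ℕ → Set
CircuitSP C sym-C = IsMaximum (λ g k → ∃[ P ] IsSP (Stab C sym-C g) P × ‖ P ‖≡ k)

{-# OPTIONS --safe #-}
module Submission where

-- The stabiliser H of a gate g has index at most s.  Write u ~ v when the
-- transposition of u and v lies in H; the classes of ~ form the coarsest
-- supporting partition.  Lower bounds on the index come from families of
-- permutations built greedily: each new factor fixes everything that the
-- earlier choices depend on.  With c the integral cube root of n one has
-- s < 2 ^ (c + 2), so off a set of O(c) points either all points are
-- equivalent or no two of them are.
--
-- The second case does not occur.  It is immediate for gates that carry a
-- tuple, and for the others, by induction along the wires, every transposition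
-- moves some child out of the set of children, while each child is fixed by all
-- transpositions off a set of O(c) points; c + 2 independent transpositions then
-- give 2 ^ (c + 2) images of g.
--
-- In the first case let K be the complement of the large class.  Exchanging
-- each point of K with any of c + 2 points of the class, in disjoint blocks,
-- gives (c + 2) ^ |K| images of g.  Hence n ^ |K| ≤ s ^ 3, which is stronger
-- than required; the slack between 3 and 33 absorbs all rounding of
-- logarithms, and ε enters only through ⅔ ≤ ε ≤ 1.

-- Permutations, and lower bounds on the index of a subgroup.

module Permutations where
  open import Data.Fin.Base using (Fin; zero; suc; combine; remQuot)
  open import Data.Fin.Permutation
    using (Permutation′; _⟨$⟩ʳ_; _⟨$⟩ˡ_; _≈_; id; flip; _∘ₚ_; transpose; inverseˡ; inverseʳ)
  import Data.Fin.Properties as Fin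
  open import Data.Fin.Properties using (_≟_; any?; pigeonhole; combine-remQuot)
  open import Data.List.Base using (List; []; _∷_; _++_; length; lookup; tabulate; allFin)
  open import Data.List.Membership.Propositional using (_∈_; _∉_)
  open import Data.List.Membership.Propositional.Properties
    using (∈-++⁺ˡ; ∈-++⁺ʳ; ∈-++⁻; ∈-tabulate⁺; ∈-tabulate⁻; ∈-allFin)
  open import Data.List.Properties using (length-++; length-tabulate)
  open import Data.List.Relation.Binary.Subset.Propositional using (_⊆_)
  import Data.List.Relation.Unary.All as All
  open import Data.List.Relation.Unary.Any using (here; there; index)
  open import Data.List.Relation.Unary.Any.Properties using (lookup-index)
  open import Data.List.Relation.Unary.AllPairs using ([]; _∷_)
  open import Data.List.Relation.Unary.Unique.Propositional using (Unique)
  open import Data.Nat.Base using (ℕ; zero; suc; _+_; _*_; _^_; _≤_; _<_; z≤n; s≤s)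
  import Data.Nat.Properties as ℕ
  open import Data.Product using (∃-syntax; Σ-syntax; _×_; _,_; uncurry)
  open import Data.Sum.Base using (_⊎_; inj₁; inj₂; [_,_]′)
  open import Function.Base using (_∘_)
  open import Relation.Binary.PropositionalEquality
    using (_≡_; _≢_; refl; sym; trans; cong; subst)
  open import Relation.Nullary using (¬_; Dec; yes; no; contradiction)
  open import Relation.Nullary.Decidable using (_×-dec_; ¬?; decidable-stable)
  import Data.List.Membership.DecPropositional as DecMembership

  private
    variable
      n : ℕ

  module _ {n : ℕ} where
    open DecMembership (_≟_ {n}) public using (_∈?_)

  transpose-left : (a b : Fin n) → transpose a b ⟨$⟩ʳ a ≡ b
  transpose-left a b with a ≟ a
  ... | yes _  = refl
  ... | no a≢a = contradiction refl a≢a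

  transpose-right : (a b : Fin n) → transpose a b ⟨$⟩ʳ b ≡ a
  transpose-right a b with b ≟ a
  ... | yes b≡a = b≡a
  ... | no _ with b ≟ b
  ...   | yes _  = refl
  ...   | no b≢b = contradiction refl b≢b

  transpose-other : {a b x : Fin n} → x ≢ a → x ≢ b → transpose a b ⟨$⟩ʳ x ≡ x
  transpose-other {a = a} {b} {x} x≢a x≢b with x ≟ a
  ... | yes x≡a = contradiction x≡a x≢a
  ... | no _ with x ≟ b
  ...   | yes x≡b = contradiction x≡b x≢b
  ...   | no _    = refl

  ⟨$⟩ʳ-injective : (σ : Permutation′ n) {x y : Fin n} → σ ⟨$⟩ʳ x ≡ σ ⟨$⟩ʳ y → x ≡ y
  ⟨$⟩ʳ-injective σ eq = trans (sym (inverseˡ σ)) (trans (cong (σ ⟨$⟩ˡ_) eq) (inverseˡ σ))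

  ⟨$⟩ˡ-image : (σ : Permutation′ n) {x y : Fin n} → σ ⟨$⟩ʳ x ≡ y → σ ⟨$⟩ˡ y ≡ x
  ⟨$⟩ˡ-image σ eq = trans (cong (σ ⟨$⟩ˡ_) (sym eq)) (inverseˡ σ)

  transpose-sym : (a b x : Fin n) → transpose a b ⟨$⟩ʳ x ≡ transpose b a ⟨$⟩ʳ x
  transpose-sym a b x = by-cases (x ≟ a) (x ≟ b)
    where
    by-cases : Dec (x ≡ a) → Dec (x ≡ b) → transpose a b ⟨$⟩ʳ x ≡ transpose b a ⟨$⟩ʳ x
    by-cases (yes refl) _          = trans (transpose-left a b) (sym (transpose-right b a))
    by-cases (no _)     (yes refl) = trans (transpose-right a b) (sym (transpose-left b a))
    by-cases (no x≢a)   (no x≢b)   =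
      trans (transpose-other x≢a x≢b) (sym (transpose-other x≢b x≢a))

  transpose-conj : (π : Permutation′ n) (a b x : Fin n) →
    π ⟨$⟩ʳ (transpose a b ⟨$⟩ʳ x) ≡ transpose (π ⟨$⟩ʳ a) (π ⟨$⟩ʳ b) ⟨$⟩ʳ (π ⟨$⟩ʳ x)
  transpose-conj π a b x = by-cases (x ≟ a) (x ≟ b)
    where
    by-cases : Dec (x ≡ a) → Dec (x ≡ b) →
      π ⟨$⟩ʳ (transpose a b ⟨$⟩ʳ x) ≡ transpose (π ⟨$⟩ʳ a) (π ⟨$⟩ʳ b) ⟨$⟩ʳ (π ⟨$⟩ʳ x)
    by-cases (yes refl) _          =
      trans (cong (π ⟨$⟩ʳ_) (transpose-left a b)) (sym (transpose-left (π ⟨$⟩ʳ a) (π ⟨$⟩ʳ b)))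
    by-cases (no _)     (yes refl) =
      trans (cong (π ⟨$⟩ʳ_) (transpose-right a b)) (sym (transpose-right (π ⟨$⟩ʳ a) (π ⟨$⟩ʳ b)))
    by-cases (no x≢a)   (no x≢b)   = trans (cong (π ⟨$⟩ʳ_) (transpose-other x≢a x≢b))
      (sym (transpose-other (x≢a ∘ ⟨$⟩ʳ-injective π) (x≢b ∘ ⟨$⟩ʳ-injective π)))

  fresh : (E : List (Fin n)) → length E < n → ∃[ x ] x ∉ E
  fresh E |E|<n with any? (λ x → ¬? (x ∈? E))
  ... | yes found = found
  -- If `E` contained every point, positions in `E` would inject `Fin n` into the smaller
  -- `Fin (length E)`.
  ... | no none = let i , j , i<j , eq = pigeonhole |E|<n (index ∘ x∈E) in
    contradiction (index-injective eq) (Fin.<⇒≢ i<j)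
    where
    x∈E : ∀ x → x ∈ E
    x∈E x = decidable-stable (x ∈? E) (λ x∉E → none (x , x∉E))
    index-injective : ∀ {i j} → index (x∈E i) ≡ index (x∈E j) → i ≡ j
    index-injective {i} {j} eq = trans (lookup-index (x∈E i))
      (trans (cong (lookup E) eq) (sym (lookup-index (x∈E j))))

  freshFamily : ∀ m (E : List (Fin n)) → length E + m ≤ n →
    Σ[ f ∈ (Fin m → Fin n) ] (∀ {i j} → i ≢ j → f i ≢ f j) × (∀ i → f i ∉ E)
  freshFamily zero    E _    = (λ ()) , (λ { {()} }) , λ ()
  freshFamily {n} (suc m) E room
    with fresh E (ℕ.≤-trans (s≤s (ℕ.m≤m+n (length E) m))
                            (subst (_≤ n) (ℕ.+-suc (length E) m) room))
  ... | x , x∉E with freshFamily m (x ∷ E) (subst (_≤ n) (ℕ.+-suc (length E) m) room)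
  ...   | f , f-inj , f∉ = f′ , f′-inj , f′∉
    where
    f′ : Fin (suc m) → Fin n
    f′ zero    = x
    f′ (suc i) = f i
    f′-inj : ∀ {i j} → i ≢ j → f′ i ≢ f′ j
    f′-inj {zero}  {zero}  i≢j _  = i≢j refl
    f′-inj {zero}  {suc j} _   eq = f∉ j (here (sym eq))
    f′-inj {suc i} {zero}  _   eq = f∉ i (here eq)
    f′-inj {suc i} {suc j} i≢j eq = f-inj (i≢j ∘ cong suc) eq
    f′∉ : ∀ i → f′ i ∉ E
    f′∉ zero    = x∉E
    f′∉ (suc i) = f∉ i ∘ there

  record IsSubgroup (H : Permutation′ n → Set) : Set where
    field
      resp    : ∀ {σ τ} → σ ≈ τ → H σ → H τ
      id∈     : H id
      ∘-closed : ∀ {σ τ} → H σ → H τ → H (σ ∘ₚ τ)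
      flip-closed : ∀ {σ} → H σ → H (flip σ)

  Fixes : List (Fin n) → Permutation′ n → Set
  Fixes E σ = ∀ {z} → z ∈ E → σ ⟨$⟩ʳ z ≡ z

  flip-Fixes : ∀ {E} {σ : Permutation′ n} → Fixes E σ → Fixes E (flip σ)
  flip-Fixes {σ = σ} fixes z∈E = ⟨$⟩ˡ-image σ (fixes z∈E)

  ∘-Fixes : ∀ {E} {σ τ : Permutation′ n} → Fixes E σ → Fixes E τ → Fixes E (σ ∘ₚ τ)
  ∘-Fixes {τ = τ} σ-fixes τ-fixes z∈E = trans (cong (τ ⟨$⟩ʳ_) (σ-fixes z∈E)) (τ-fixes z∈E)

  transpose-Fixes : ∀ {E} {u v : Fin n} → u ∉ E → v ∉ E → Fixes E (transpose u v)
  transpose-Fixes {E = E} u∉E v∉E z∈E = transpose-other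
    (λ z≡u → u∉E (subst (_∈ E) z≡u z∈E)) (λ z≡v → v∉E (subst (_∈ E) z≡v z∈E))

  module Subgroup {n : ℕ} {H : Permutation′ n → Set} (isSubgroup : IsSubgroup H) where
    open IsSubgroup isSubgroup

    infix 4 _~_

    _~_ : Fin n → Fin n → Set
    a ~ b = H (transpose a b)

    ~-refl : ∀ a → a ~ a
    ~-refl a = resp lemma id∈
      where
      lemma : ∀ x → x ≡ transpose a a ⟨$⟩ʳ x
      lemma x with x ≟ a
      ... | yes x≡a = x≡a
      ... | no x≢a with x ≟ a
      ...   | yes x≡a = contradiction x≡a x≢a
      ...   | no _    = refl

    ~-sym : ∀ {a b} → a ~ b → b ~ a
    ~-sym {a} {b} a~b = resp (λ _ → refl) (flip-closed a~b)

    -- Conjugating `transpose a b` by `π` yields the transposition of the images. So members of `H`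
    -- preserve `~`, and a permutation that breaks some equivalence lies outside `H`.
    ~-move : ∀ {π a b a′ b′} → H π → π ⟨$⟩ʳ a ≡ a′ → π ⟨$⟩ʳ b ≡ b′ → a ~ b → a′ ~ b′
    ~-move {π} {a} {b} Hπ refl refl a~b =
      resp (λ x → trans (transpose-conj π a b (π ⟨$⟩ˡ x))
                        (cong (transpose _ _ ⟨$⟩ʳ_) (inverseʳ π)))
        (∘-closed (flip-closed Hπ) (∘-closed a~b Hπ))

    ~-move⁻¹ : ∀ {π a b a′ b′} → H π → π ⟨$⟩ʳ a ≡ a′ → π ⟨$⟩ʳ b ≡ b′ → a′ ~ b′ → a ~ b
    ~-move⁻¹ {π} Hπ πa πb = ~-move (flip-closed Hπ) (⟨$⟩ˡ-image π πa) (⟨$⟩ˡ-image π πb)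

    ~-trans : ∀ {a b c} → a ~ b → b ~ c → a ~ c
    ~-trans {a} {b} {c} a~b b~c with c ≟ a | c ≟ b
    ... | yes refl | _        = ~-refl a
    ... | no _     | yes refl = a~b
    ... | no c≢a   | no c≢b   =
      ~-move a~b (transpose-right a b) (transpose-other c≢a c≢b) b~c

    -- The list in `go` contains every point that `σ` moves. If `σ` moves its head `u` to `v`,
    -- following `σ` by `transpose u v` fixes `u`, moves no new point and keeps `E` fixed.
    generated : ∀ E → (∀ u v → u ∉ E → v ∉ E → u ~ v) → ∀ {σ} → Fixes E σ → H σ
    generated E E-class fixes = go (allFin n) (λ {z} z∉ → contradiction (∈-allFin z) z∉) fixes
      where
      go : ∀ L {σ} → (∀ {z} → z ∉ L → σ ⟨$⟩ʳ z ≡ z) → Fixes E σ → H σ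
      go []      outside _ = resp (λ z → sym (outside {z} λ ())) id∈
      go (u ∷ L) {σ} outside fixes with σ ⟨$⟩ʳ u ≟ u
      ... | yes σu≡u = go L {σ} outside′ fixes
        where
        outside′ : ∀ {z} → z ∉ L → σ ⟨$⟩ʳ z ≡ z
        outside′ {z} z∉L with z ≟ u
        ... | yes refl = σu≡u
        ... | no z≢u   = outside λ { (here z≡u) → z≢u z≡u ; (there z∈L) → z∉L z∈L }
      ... | no σu≢u = resp cancel (∘-closed (go L {σ ∘ₚ transpose u v} outside′ fixes′) (~-sym u~v))
        where
        v = σ ⟨$⟩ʳ u
        σv≢v : σ ⟨$⟩ʳ v ≢ v
        σv≢v σv≡v = σu≢u (⟨$⟩ʳ-injective σ σv≡v)
        u∉E : u ∉ E
        u∉E u∈E = σu≢u (fixes u∈E)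
        v∉E : v ∉ E
        v∉E v∈E = σv≢v (fixes v∈E)
        u~v = E-class u v u∉E v∉E
        fixes′ : Fixes E (σ ∘ₚ transpose u v)
        fixes′ = ∘-Fixes {σ = σ} {transpose u v} fixes (transpose-Fixes u∉E v∉E)
        outside′ : ∀ {z} → z ∉ L → transpose u v ⟨$⟩ʳ (σ ⟨$⟩ʳ z) ≡ z
        outside′ {z} z∉L with z ≟ u
        ... | yes refl = transpose-right u v
        ... | no z≢u   = trans (cong (transpose u v ⟨$⟩ʳ_) σz≡z)
                               (transpose-other z≢u (λ { refl → σv≢v σz≡z }))
          where
          σz≡z : σ ⟨$⟩ʳ z ≡ z
          σz≡z = outside λ { (here z≡u) → z≢u z≡u ; (there z∈L) → z∉L z∈L }
        cancel : ∀ x → transpose v u ⟨$⟩ʳ (transpose u v ⟨$⟩ʳ (σ ⟨$⟩ʳ x)) ≡ σ ⟨$⟩ʳ x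
        cancel x = inverseˡ (transpose u v)

    -- When H is the stabiliser of g and σ ∘ₚ flip σ′ separates E, the images
    -- σ (ρ g) and σ′ (ρ′ g) differ for all ρ and ρ′ fixing E.
    Separates : List (Fin n) → Permutation′ n → Set
    Separates E π = ∀ ρ ρ′ → Fixes E ρ → Fixes E ρ′ → ¬ H (ρ ∘ₚ π ∘ₚ ρ′)

    Separates-flip : ∀ {E π} → Separates E π → Separates E (flip π)
    Separates-flip {E} {π} sep ρ ρ′ ρ-fixes ρ′-fixes h =
      sep (flip ρ′) (flip ρ) (flip-Fixes {σ = ρ′} ρ′-fixes) (flip-Fixes {σ = ρ} ρ-fixes)
        (resp (λ _ → refl) (flip-closed h))

    Separates-resp : ∀ {E} π π′ → π ≈ π′ → Separates E π → Separates E π′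
    Separates-resp π π′ eq sep ρ ρ′ ρ-fixes ρ′-fixes h =
      sep ρ ρ′ ρ-fixes ρ′-fixes (resp (λ x → cong (ρ′ ⟨$⟩ʳ_) (sym (eq (ρ ⟨$⟩ʳ x)))) h)

    -- Separation relative to `E`, rather than mere non-membership in `H`, lets later factors that
    -- fix `E` be put in front.
    Family : List (Fin n) → ℕ → Set
    Family E N = Σ[ f ∈ (Fin N → Permutation′ n) ]
      (∀ {i j} → i ≢ j → Separates E (f i ∘ₚ flip (f j)))

    Branching : List (Fin n) → List (Fin n) → ℕ → Set
    Branching E E′ m = E ⊆ E′ × Σ[ τ ∈ (Fin m → Permutation′ n) ]
      (∀ c → Fixes E (τ c)) × (∀ {c c′} → c ≢ c′ → Separates E′ (τ c ∘ₚ flip (τ c′)))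

    singleton : Family [] 1
    singleton = (λ _ → id) , λ { {zero} {zero} 0≢0 → contradiction refl 0≢0 }

    -- For different earlier members, the new factors fix `E` and are absorbed into `ρ` and `ρ′`;
    -- equal earlier members cancel, and the new factors separate.
    extend : ∀ {E E′ m N} → Branching E E′ m → Family E N → Family E′ (m * N)
    extend {E} {E′} {m} {N} (E⊆E′ , τ , τ-fixes , τ-sep) (f , f-sep) =
      F ∘ split , λ x≢y → F-sep (x≢y ∘ split-injective)
      where
      split : Fin (m * N) → Fin m × Fin N
      split = remQuot N
      split-injective : ∀ {x y} → split x ≡ split y → x ≡ y
      split-injective {x} {y} eq = trans (sym (combine-remQuot {m} N x))
        (trans (cong (uncurry combine) eq) (combine-remQuot {m} N y))
      F : Fin m × Fin N → Permutation′ n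
      F (c , i) = τ c ∘ₚ f i
      F-sep : ∀ {p p′} → p ≢ p′ → Separates E′ (F p ∘ₚ flip (F p′))
      F-sep {c , i} {c′ , j} p≢p′ ρ ρ′ ρ-fixes ρ′-fixes h with i ≟ j | c ≟ c′
      ... | yes refl | yes refl = p≢p′ refl
      ... | yes refl | no c≢c′  = τ-sep c≢c′ ρ ρ′ ρ-fixes ρ′-fixes
        (resp {ρ ∘ₚ (F (c , i) ∘ₚ flip (F (c′ , i))) ∘ₚ ρ′}
          (λ _ → cong (λ z → ρ′ ⟨$⟩ʳ (τ c′ ⟨$⟩ˡ z)) (inverseˡ (f i))) h)
      ... | no i≢j   | _        = f-sep i≢j (ρ ∘ₚ τ c) (flip (τ c′) ∘ₚ ρ′)
        (∘-Fixes {σ = ρ} {τ c} (ρ-fixes ∘ E⊆E′) (τ-fixes c))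
        (∘-Fixes {σ = flip (τ c′)} {ρ′} (flip-Fixes {σ = τ c′} (τ-fixes c′)) (ρ′-fixes ∘ E⊆E′))
        (resp (λ _ → refl) h)

    branch₂ : ∀ {E E′ u v} → E ⊆ E′ → u ∉ E → v ∉ E → Separates E′ (transpose u v) →
              Branching E E′ 2
    branch₂ {E} {E′} {u} {v} E⊆E′ u∉E v∉E sep = E⊆E′ , τ , τ-fixes , τ-sep
      where
      τ : Fin 2 → Permutation′ n
      τ zero    = id
      τ (suc _) = transpose u v
      τ-fixes : ∀ c → Fixes E (τ c)
      τ-fixes zero    _ = refl
      τ-fixes (suc c)   = transpose-Fixes u∉E v∉E
      τ-sep : ∀ {c c′} → c ≢ c′ → Separates E′ (τ c ∘ₚ flip (τ c′))
      τ-sep {zero}     {zero}     c≢c′ = contradiction refl c≢c′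
      τ-sep {suc zero} {suc zero} c≢c′ = contradiction refl c≢c′
      τ-sep {zero}     {suc zero} _    = Separates-resp
        (flip (transpose u v)) (id ∘ₚ flip (transpose u v)) (λ _ → refl)
        (Separates-flip {π = transpose u v} sep)
      τ-sep {suc zero} {zero}     _    = Separates-resp
        (transpose u v) (transpose u v ∘ₚ flip id) (λ _ → refl) sep

    -- Greedy construction: each round multiplies the family by `m` at the cost of at most `k`
    -- further points, unless it stops at a list satisfying `P`, which is then still short.
    grow : ∀ {P : List (Fin n) → Set} m k →
      (∀ E → (∃[ E′ ] length E′ ≤ k + length E × Branching E E′ m) ⊎ P E) →
      ∀ t → (∃[ E ] length E ≤ t * k × Family E (m ^ t)) ⊎ (∃[ E ] length E ≤ t * k × P E)
    grow m k step zero    = inj₁ ([] , z≤n , singleton)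
    grow m k step (suc t) with grow m k step t
    ... | inj₂ (E , |E| , stuck)  = inj₂ (E , ℕ.≤-trans |E| (ℕ.m≤n+m _ k) , stuck)
    ... | inj₁ (E , |E| , family) with step E
    ...   | inj₂ stuck = inj₂ (E , ℕ.≤-trans |E| (ℕ.m≤n+m _ k) , stuck)
    ...   | inj₁ (E′ , |E′| , branching) =
      inj₁ (E′ , ℕ.≤-trans |E′| (ℕ.+-monoʳ-≤ k |E|) , extend branching family)

    -- The condition on `f` puts its members into distinct cosets, so this bounds the index without
    -- forming the quotient.
    Index≤ : ℕ → Set
    Index≤ s = ∀ {N} (f : Fin N → Permutation′ n) →
      (∀ {i j} → i ≢ j → ¬ H (f i ∘ₚ flip (f j))) → N ≤ s

    family-≤ : ∀ {s E N} → Index≤ s → Family E N → N ≤ s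
    family-≤ index≤ (f , sep) = index≤ f λ i≢j h →
      sep i≢j id id (λ _ → refl) (λ _ → refl) (resp (λ _ → refl) h)

    Equivalent Inequivalent : List (Fin n) → Set
    Equivalent   E = ∀ u v → u ∉ E → v ∉ E → u ~ v
    Inequivalent E = ∀ u v → u ∉ E → v ∉ E → u ≢ v → ¬ u ~ v

    -- Otherwise there are many disjoint triples a, b, c with a ~ b and not
    -- a ~ c; any selection of the transpositions of b and c can be read off
    -- from its effect on _~_.
    dichotomy : (∀ σ → Dec (H σ)) → ∀ {s d} → Index≤ s → s < 2 ^ d →
      (∃[ E ] length E ≤ d * 3 × Equivalent E) ⊎ (∃[ E ] length E ≤ d * 3 × Inequivalent E)
    dichotomy H? {s} {d} index≤ s<2^d = [ grown , stuck ]′ (grow 2 3 step d)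
      where
      Mixed : List (Fin n) → Fin n → Fin n → Fin n → Set
      Mixed E a b c = a ∉ E × b ∉ E × c ∉ E × a ≢ b × a ~ b × ¬ a ~ c
      mixed? : ∀ E → Dec (∃[ a ] ∃[ b ] ∃[ c ] Mixed E a b c)
      mixed? E = any? λ a → any? λ b → any? λ c →
        ¬? (a ∈? E) ×-dec ¬? (b ∈? E) ×-dec ¬? (c ∈? E) ×-dec
        ¬? (a ≟ b) ×-dec H? (transpose a b) ×-dec ¬? (H? (transpose a c))
      step : ∀ E → (∃[ E′ ] length E′ ≤ 3 + length E × Branching E E′ 2) ⊎
                   (¬ (∃[ a ] ∃[ b ] ∃[ c ] Mixed E a b c))
      step E with mixed? E
      ... | no none = inj₂ none
      ... | yes (a , b , c , a∉E , b∉E , c∉E , a≢b , a~b , a≁c) =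
        inj₁ (E′ , ℕ.≤-refl , branch₂ (there ∘ there ∘ there) b∉E c∉E sep)
        where
        E′ = a ∷ b ∷ c ∷ E
        a≢c : a ≢ c
        a≢c refl = a≁c (~-refl a)
        sep : Separates E′ (transpose b c)
        -- The product still sends `a` to `a` and `b` to `c`; as a member of `H` it would turn
        -- `a ~ b` into `a ~ c`.
        sep ρ ρ′ ρ-fixes ρ′-fixes h = a≁c (~-move h
          (trans (cong (λ z → ρ′ ⟨$⟩ʳ (transpose b c ⟨$⟩ʳ z)) (ρ-fixes (here refl)))
            (trans (cong (ρ′ ⟨$⟩ʳ_) (transpose-other a≢b a≢c)) (ρ′-fixes (here refl))))
          (trans (cong (λ z → ρ′ ⟨$⟩ʳ (transpose b c ⟨$⟩ʳ z)) (ρ-fixes (there (here refl))))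
            (trans (cong (ρ′ ⟨$⟩ʳ_) (transpose-left b c)) (ρ′-fixes (there (there (here refl))))))
          a~b)
      Outcome : Set
      Outcome = (∃[ E ] length E ≤ d * 3 × Equivalent E) ⊎
                (∃[ E ] length E ≤ d * 3 × Inequivalent E)
      grown : ∃[ E ] length E ≤ d * 3 × Family E (2 ^ d) → Outcome
      grown (E , _ , family) = contradiction (family-≤ index≤ family) (ℕ.<⇒≱ s<2^d)
      stuck : ∃[ E ] length E ≤ d * 3 × (¬ (∃[ a ] ∃[ b ] ∃[ c ] Mixed E a b c)) → Outcome
      stuck (E , |E| , none) with any? (λ a → any? λ b →
        ¬? (a ∈? E) ×-dec ¬? (b ∈? E) ×-dec ¬? (a ≟ b) ×-dec H? (transpose a b))
      ... | no none′ = inj₂ (E , |E| , λ u v u∉E v∉E u≢v u~v →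
              none′ (u , v , u∉E , v∉E , u≢v , u~v))
      -- No mixed triple is left off `E`, so one equivalent pair makes every point off `E`
      -- equivalent to `a`.
      ... | yes (a , b , a∉E , b∉E , a≢b , a~b) = inj₁ (E , |E| , λ _ _ u∉E v∉E →
              ~-trans (~-sym (a~ u∉E)) (a~ v∉E))
        where
        a~ : ∀ {c} → c ∉ E → a ~ c
        a~ {c} c∉E = decidable-stable (H? (transpose a c)) λ a≁c →
          none (a , b , c , a∉E , b∉E , c∉E , a≢b , a~b , a≁c)

    -- While two points remain off `E₀` and the list built so far, their transposition doubles the
    -- family. The assumption on `n` lets all `d` rounds succeed, and `2 ^ d` members exceed the
    -- index.
    separable⇒large : ∀ {s d k E₀} → Index≤ s → s < 2 ^ d →
      length E₀ + d * k + 2 ≤ n →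
      ¬ (∀ u v → u ∉ E₀ → v ∉ E₀ → u ≢ v →
           ∃[ T ] length T ≤ k × Separates T (transpose u v))
    separable⇒large {s} {d} {k} {E₀} index≤ s<2^d room separable =
      [ grown , stuck ]′ (grow 2 k step d)
      where
      step : ∀ E → (∃[ E′ ] length E′ ≤ k + length E × Branching E E′ 2) ⊎
                   (¬ length (E₀ ++ E) + 2 ≤ n)
      step E with length (E₀ ++ E) + 2 ℕ.≤? n
      ... | no full = inj₂ full
      ... | yes room with freshFamily 2 (E₀ ++ E) room
      ...   | f , f-inj , f∉ with separable (f zero) (f (suc zero))
                                              (f∉ zero ∘ ∈-++⁺ˡ) (f∉ (suc zero) ∘ ∈-++⁺ˡ)
                                            (f-inj {zero} {suc zero} λ ())
      ...     | T , |T| , sep = inj₁ (T ++ E ,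
        ℕ.≤-trans (ℕ.≤-reflexive (length-++ T)) (ℕ.+-monoˡ-≤ (length E) |T|) ,
        branch₂ (∈-++⁺ʳ T) (f∉ zero ∘ ∈-++⁺ʳ E₀) (f∉ (suc zero) ∘ ∈-++⁺ʳ E₀)
          (λ ρ ρ′ ρ-fixes ρ′-fixes → sep ρ ρ′ (ρ-fixes ∘ ∈-++⁺ˡ) (ρ′-fixes ∘ ∈-++⁺ˡ)))
      grown : ¬ (∃[ E ] length E ≤ d * k × Family E (2 ^ d))
      grown (E , _ , family) = ℕ.<⇒≱ s<2^d (family-≤ index≤ family)
      stuck : ¬ (∃[ E ] length E ≤ d * k × ¬ length (E₀ ++ E) + 2 ≤ n)
      stuck (E , |E| , full) = full (ℕ.≤-trans
        (ℕ.+-monoˡ-≤ 2 (ℕ.≤-trans (ℕ.≤-reflexive (length-++ E₀)) (ℕ.+-monoʳ-≤ (length E₀) |E|)))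
        room)

    -- Each k ∈ K can be exchanged with any element of its own block of m
    -- elements equivalent to b; the exchanges made are determined by which
    -- elements are no longer equivalent to b.
    exchange : ∀ {s} m b K → Unique K → (∀ {x} → x ∈ K → ¬ x ~ b) → (∀ {x} → x ∉ K → x ~ b) →
      Index≤ s → suc (length K * (2 + m) + length K) + m ≤ n → m ^ length K ≤ s
    exchange {s} m b K unique-K K≁b ∉K~b index≤ room =
      let _ , _ , _ , family = go K unique-K K≁b ℕ.≤-refl in family-≤ index≤ family
      where
      -- `E` stays inside `ks` and the class of `b`; the next point of `K` is in neither, so it lies
      -- off `E`.
      go : ∀ ks → Unique ks → (∀ {x} → x ∈ ks → ¬ x ~ b) → length ks ≤ length K →
        ∃[ E ] length E ≤ length ks * (2 + m) × (∀ {x} → x ∈ E → x ∈ ks ⊎ x ~ b) ×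
               Family E (m ^ length ks)
      go []       _                 _    _ = [] , z≤n , (λ ()) , singleton
      go (k ∷ ks) (k∉ks ∷ unique-ks) ks≁b |ks|
        with go ks unique-ks (ks≁b ∘ there) (ℕ.≤-trans (ℕ.n≤1+n _) |ks|)
      ... | E , |E| , E⊆ , family
        -- Avoiding `K` makes the new points equivalent to `b`; avoiding `E` and `b` keeps the
        -- exchanges from moving these.
        with freshFamily m (b ∷ E ++ K) (ℕ.≤-trans (ℕ.+-monoˡ-≤ m (s≤s
               (ℕ.≤-trans (ℕ.≤-reflexive (length-++ E)) (ℕ.+-monoˡ-≤ (length K)
                 (ℕ.≤-trans |E| (ℕ.*-monoˡ-≤ (2 + m) (ℕ.≤-trans (ℕ.n≤1+n _) |ks|)))))))
               room)
      ...   | D , D-inj , D∉ = E′ , |E′| , E′⊆ , extend (E⊆E′ , τ , τ-fixes , τ-sep) family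
        where
        E′ = k ∷ b ∷ tabulate D ++ E
        |E′| : length E′ ≤ (2 + m) + length ks * (2 + m)
        |E′| = s≤s (s≤s (ℕ.≤-trans
          (ℕ.≤-reflexive (trans (length-++ (tabulate D)) (cong (_+ length E) (length-tabulate D))))
          (ℕ.+-monoʳ-≤ m |E|)))
        D≢b : ∀ c → D c ≢ b
        D≢b c = D∉ c ∘ here
        D∉E : ∀ c → D c ∉ E
        D∉E c = D∉ c ∘ there ∘ ∈-++⁺ˡ
        D~b : ∀ c → D c ~ b
        D~b c = ∉K~b (D∉ c ∘ there ∘ ∈-++⁺ʳ E)
        k≁b : ¬ k ~ b
        k≁b = ks≁b (here refl)
        b≢k : b ≢ k
        b≢k refl = k≁b (~-refl b)
        k∉E : k ∉ E
        k∉E k∈E = [ (λ k∈ks → All.lookup k∉ks k∈ks refl) , k≁b ]′ (E⊆ k∈E)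
        E′⊆ : ∀ {x} → x ∈ E′ → x ∈ k ∷ ks ⊎ x ~ b
        E′⊆ (here refl)         = inj₁ (here refl)
        E′⊆ (there (here refl)) = inj₂ (~-refl b)
        E′⊆ (there (there x∈)) with ∈-++⁻ (tabulate D) x∈
        ... | inj₁ x∈D = let c , x≡Dc = ∈-tabulate⁻ x∈D in inj₂ (subst (_~ b) (sym x≡Dc) (D~b c))
        ... | inj₂ x∈E = [ inj₁ ∘ there , inj₂ ]′ (E⊆ x∈E)
        E⊆E′ : E ⊆ E′
        E⊆E′ = there ∘ there ∘ ∈-++⁺ʳ (tabulate D)
        τ : Fin m → Permutation′ n
        τ c = transpose k (D c)
        τ-fixes : ∀ c → Fixes E (τ c)
        τ-fixes c = transpose-Fixes k∉E (D∉E c)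
        τ-sep : ∀ {c c′} → c ≢ c′ → Separates E′ (τ c ∘ₚ flip (τ c′))
        -- Exchanging `k` with `D c` and undoing the exchange with `D c′` takes `k` to `D c` and
        -- fixes `b`, so membership in `H` would pull `D c ~ b` back to `k ~ b`.
        τ-sep {c} {c′} c≢c′ ρ ρ′ ρ-fixes ρ′-fixes h = k≁b (~-move⁻¹ h πk πb (D~b c))
          where
          π = ρ ∘ₚ (τ c ∘ₚ flip (τ c′)) ∘ₚ ρ′
          Dc≢k : D c ≢ k
          Dc≢k Dc≡k = k≁b (subst (_~ b) Dc≡k (D~b c))
          πk : π ⟨$⟩ʳ k ≡ D c
          πk = trans (cong (λ z → ρ′ ⟨$⟩ʳ (τ c′ ⟨$⟩ˡ (τ c ⟨$⟩ʳ z))) (ρ-fixes (here refl)))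
            (trans (cong (λ z → ρ′ ⟨$⟩ʳ (τ c′ ⟨$⟩ˡ z)) (transpose-left k (D c)))
            (trans (cong (ρ′ ⟨$⟩ʳ_) (transpose-other (D-inj c≢c′) Dc≢k))
                   (ρ′-fixes (there (there (∈-++⁺ˡ (∈-tabulate⁺ c)))))))
          πb : π ⟨$⟩ʳ b ≡ b
          πb = trans (cong (λ z → ρ′ ⟨$⟩ʳ (τ c′ ⟨$⟩ˡ (τ c ⟨$⟩ʳ z))) (ρ-fixes (there (here refl))))
            (trans (cong (λ z → ρ′ ⟨$⟩ʳ (τ c′ ⟨$⟩ˡ z)) (transpose-other b≢k (D≢b c ∘ sym)))
            (trans (cong (ρ′ ⟨$⟩ʳ_) (transpose-other (D≢b c′ ∘ sym) b≢k))
                   (ρ′-fixes (there (here refl)))))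

-- Supporting partitions, and symmetric circuits.

module Circuits where
  open import Data.Fin.Base using (Fin; zero; suc)
  open import Data.Fin.Induction using (spo-wellFounded)
  import Data.Fin.Permutation as Perm
  open import Data.Fin.Permutation
    using (Permutation′; _⟨$⟩ʳ_; _⟨$⟩ˡ_; _≈_; flip; _∘ₚ_; transpose; inverseˡ; inverseʳ)
  open import Data.Fin.Properties using (_≟_; any?)
  import Data.Fin.Subset as Subset
  import Data.Fin.Subset.Properties as Subset
  open import Data.Fin.Subset using (Subset; inside; outside; ∣_∣)
  open import Data.List.Base using (List; []; _∷_; _++_; length; lookup; filter; allFin)
  open import Data.List.Membership.Propositional using (_∈_; _∉_)
  open import Data.List.Membership.Propositional.Properties
    using (∈-++⁺ˡ; ∈-++⁺ʳ; ∈-tabulate⁻; ∈-filter⁺; ∈-filter⁻; ∈-allFin; ∈-lookup)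
  open import Data.List.Properties using (length-++; length-tabulate)
  import Data.List.Relation.Unary.All as All
  open import Data.List.Relation.Unary.Any using (here; there; index)
  open import Data.List.Relation.Unary.Any.Properties using (lookup-index)
  open import Data.List.Relation.Unary.AllPairs using ([]; _∷_)
  open import Data.List.Relation.Unary.Unique.Propositional using (Unique)
  import Data.List.Relation.Unary.Unique.Propositional.Properties as Unique
  open import Data.Nat.Base using (ℕ; zero; suc; _+_; _*_; _^_; _≤_; _<_; z≤n; s≤s)
  import Data.Nat.Properties as ℕ
  open import Data.Product using (∃-syntax; _×_; _,_; proj₁; proj₂)
  open import Data.Sum.Base using (inj₁; inj₂)
  open import Data.Vec.Base as Vec using (Vec; []; _∷_)
  import Data.Vec.Properties as Vec
  open import Function.Base using (_∘_)
  open import Function.Bundles using (mk⇔; Equivalence)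
  open import Induction.WellFounded using (WellFounded; Acc; acc)
  open import Relation.Binary.Construct.Closure.Transitive as Closure using (TransClosure; [_])
  open import Relation.Binary.PropositionalEquality
    using (_≡_; _≢_; refl; sym; trans; cong; subst; isEquivalence)
  open import Relation.Binary.PropositionalEquality.WithK using (≡-irrelevant)
  open import Relation.Nullary using (¬_; Dec; yes; no; contradiction)
  open import Relation.Nullary.Decidable using (_×-dec_; ¬?; decidable-stable)

  open import Defs hiding (_≤_; _<_; _*_; _-_; _^_)
  open Permutations

  private
    variable
      n : ℕ

  ∣p∪q∣≤∣p∣+∣q∣ : (p q : Subset n) → ∣ p Subset.∪ q ∣ ≤ ∣ p ∣ + ∣ q ∣
  ∣p∪q∣≤∣p∣+∣q∣ []            []            = z≤n
  ∣p∪q∣≤∣p∣+∣q∣ (inside  ∷ p) (inside  ∷ q) = s≤s (ℕ.≤-trans (∣p∪q∣≤∣p∣+∣q∣ p q)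
                                                     (ℕ.+-monoʳ-≤ ∣ p ∣ (ℕ.n≤1+n _)))
  ∣p∪q∣≤∣p∣+∣q∣ (inside  ∷ p) (outside ∷ q) = s≤s (∣p∪q∣≤∣p∣+∣q∣ p q)
  ∣p∪q∣≤∣p∣+∣q∣ (outside ∷ p) (inside  ∷ q) = ℕ.≤-trans (s≤s (∣p∪q∣≤∣p∣+∣q∣ p q))
                                                (ℕ.≤-reflexive (sym (ℕ.+-suc ∣ p ∣ ∣ q ∣)))
  ∣p∪q∣≤∣p∣+∣q∣ (outside ∷ p) (outside ∷ q) = ∣p∪q∣≤∣p∣+∣q∣ p q

  fromList : List (Fin n) → Subset n
  fromList []       = Subset.⊥
  fromList (x ∷ xs) = Subset.⁅ x ⁆ Subset.∪ fromList xs

  fromList⁺ : ∀ {xs} {x : Fin n} → x ∈ xs → x Subset.∈ fromList xs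
  fromList⁺ {x = x} (here refl) = Subset.x∈p∪q⁺ (inj₁ (Subset.x∈⁅x⁆ x))
  fromList⁺ (there x∈xs)        = Subset.x∈p∪q⁺ (inj₂ (fromList⁺ x∈xs))

  fromList⁻ : ∀ xs {x : Fin n} → x Subset.∈ fromList xs → x ∈ xs
  fromList⁻ []       x∈ = contradiction x∈ Subset.∉⊥
  fromList⁻ (y ∷ xs) x∈ with Subset.x∈p∪q⁻ Subset.⁅ y ⁆ (fromList xs) x∈
  ... | inj₁ x∈⁅y⁆ = here (Subset.x∈⁅y⁆⇒x≡y y x∈⁅y⁆)
  ... | inj₂ x∈xs  = there (fromList⁻ xs x∈xs)

  ∣fromList∣≤length : (xs : List (Fin n)) → ∣ fromList xs ∣ ≤ length xs
  ∣fromList∣≤length {n} [] = ℕ.≤-reflexive (Subset.∣⊥∣≡0 n)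
  ∣fromList∣≤length (x ∷ xs) = ℕ.≤-trans (∣p∪q∣≤∣p∣+∣q∣ Subset.⁅ x ⁆ (fromList xs))
    (ℕ.+-mono-≤ (ℕ.≤-reflexive (Subset.∣⁅x⁆∣≡1 x)) (∣fromList∣≤length xs))

  ∣p∣≤length : ∀ (p : Subset n) xs → (∀ {x} → x Subset.∈ p → x ∈ xs) → ∣ p ∣ ≤ length xs
  ∣p∣≤length p xs p⊆xs =
    ℕ.≤-trans (Subset.p⊆q⇒∣p∣≤∣q∣ (fromList⁺ ∘ p⊆xs)) (∣fromList∣≤length xs)

  length≤∣p∣ : ∀ (p : Subset n) {xs} → Unique xs → (∀ {x} → x ∈ xs → x Subset.∈ p) →
               length xs ≤ ∣ p ∣
  length≤∣p∣ p []                _    = z≤n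
  length≤∣p∣ p (_∷_ {x} x∉xs unique) xs⊆p = ℕ.≤-<-trans
    (length≤∣p∣ (p Subset.- x) unique λ y∈xs →
      Subset.x∈p∧x≢y⇒x∈p-y (xs⊆p (there y∈xs)) (All.lookup x∉xs y∈xs ∘ sym))
    (Subset.x∈p⇒∣p-x∣<∣p∣ (xs⊆p (here refl)))

  Unique-⊆⇒length≤ : ∀ {xs ys : List (Fin n)} → Unique xs → (∀ {x} → x ∈ xs → x ∈ ys) →
                     length xs ≤ length ys
  Unique-⊆⇒length≤ {ys = ys} unique xs⊆ys =
    ℕ.≤-trans (length≤∣p∣ (fromList ys) unique (fromList⁺ ∘ xs⊆ys)) (∣fromList∣≤length ys)

  Unique-lookup-injective : ∀ {xs : List (Fin n)} → Unique xs → ∀ i j →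
                            lookup xs i ≡ lookup xs j → i ≡ j
  Unique-lookup-injective (_     ∷ _) zero    zero    _  = refl
  Unique-lookup-injective (x∉xs ∷ _) zero    (suc j) eq =
    contradiction eq (All.lookup x∉xs (∈-lookup j))
  Unique-lookup-injective (x∉xs ∷ _) (suc i) zero    eq =
    contradiction (sym eq) (All.lookup x∉xs (∈-lookup i))
  Unique-lookup-injective (_ ∷ uniq) (suc i) (suc j) eq =
    cong suc (Unique-lookup-injective uniq i j eq)

  -- Stabilising this partition means fixing `K` pointwise; `b` keeps the part `∁ (fromList K)`
  -- nonempty.
  singletons : ∀ {K : List (Fin n)} {b} → Unique K → b ∉ K → Partition n
  singletons {n} {K} {b} unique b∉K = record
    { parts = suc (length K) ; part = P ; nonempty = P-nonempty
    ; covering = P-covering ; disjoint = P-disjoint }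
    where
    P : Fin (suc (length K)) → Subset n
    P zero    = Subset.∁ (fromList K)
    P (suc i) = Subset.⁅ lookup K i ⁆
    P-nonempty : ∀ i → Subset.Nonempty (P i)
    P-nonempty zero    = b , Subset.x∉p⇒x∈∁p (b∉K ∘ fromList⁻ K)
    P-nonempty (suc i) = lookup K i , Subset.x∈⁅x⁆ _
    P-covering : ∀ u → ∃[ i ] u Subset.∈ P i
    P-covering u with u ∈? K
    ... | no u∉K  = zero , Subset.x∉p⇒x∈∁p (u∉K ∘ fromList⁻ K)
    ... | yes u∈K = suc (index u∈K) ,
      subst (λ v → u Subset.∈ Subset.⁅ v ⁆) (lookup-index u∈K) (Subset.x∈⁅x⁆ u)
    apart : ∀ i u → u Subset.∈ P zero → ¬ (u Subset.∈ P (suc i))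
    apart i u u∈B u∈i = Subset.x∈∁p⇒x∉p u∈B
      (fromList⁺ (subst (_∈ K) (sym (Subset.x∈⁅y⁆⇒x≡y (lookup K i) u∈i)) (∈-lookup i)))
    P-disjoint : ∀ i j u → u Subset.∈ P i → u Subset.∈ P j → i ≡ j
    P-disjoint zero    zero    _ _   _   = refl
    P-disjoint zero    (suc j) u u∈B u∈j = contradiction u∈j (apart j u u∈B)
    P-disjoint (suc i) zero    u u∈i u∈B = contradiction u∈i (apart i u u∈B)
    P-disjoint (suc i) (suc j) u u∈i u∈j = cong suc (Unique-lookup-injective unique i j
      (trans (sym (Subset.x∈⁅y⁆⇒x≡y _ u∈i)) (Subset.x∈⁅y⁆⇒x≡y _ u∈j)))

  singletons-stab : ∀ {K : List (Fin n)} {b} (unique : Unique K) (b∉K : b ∉ K) {σ} →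
                    PartitionStab (singletons unique b∉K) σ → Fixes K σ
  singletons-stab {K = K} unique b∉K {σ} stab {x} x∈K = subst (λ y → σ ⟨$⟩ʳ y ≡ y)
    (sym (lookup-index x∈K)) (trans (cong (σ ⟨$⟩ʳ_) (sym σ⁻¹y≡y)) (inverseʳ σ))
    where
    y = lookup K (index x∈K)
    -- `image` is defined through the inverse, so evaluating the equation of parts at `y` speaks of
    -- `σ ⟨$⟩ˡ y`.
    σ⁻¹y≡y : σ ⟨$⟩ˡ y ≡ y
    σ⁻¹y≡y = Subset.x∈⁅y⁆⇒x≡y y (Vec.lookup⇒[]= (σ ⟨$⟩ˡ y) Subset.⁅ y ⁆
      (trans (sym (Vec.lookup∘tabulate _ y))
        (trans (cong (λ S → Vec.lookup S y) (stab (suc (index x∈K))))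
               (Vec.[]=⇒lookup (Subset.x∈⁅x⁆ y)))))

  -- The partition into singletons of `K` and the rest supports `H`, so some part of the coarsest
  -- one contains that rest. The complement of this part lies in `K`, and the norm is a minimum.
  SP-norm-≤ : ∀ {H : Permutation′ n → Set} {P K b w} → Unique K → b ∉ K →
              (∀ {σ} → Fixes K σ → H σ) → IsSP H P → ‖ P ‖≡ w → w ≤ length K
  SP-norm-≤ {P = P} {K} {w = w} unique b∉K supported (_ , coarsest) (w≤ , _)
    with coarsest (singletons unique b∉K)
           (λ σ stab → supported (singletons-stab unique b∉K {σ} stab)) zero
  ... | j , ∁K⊆Pj = ℕ.≤-trans (w≤ j) (∣p∣≤length (Subset.∁ (part P j)) K
    (λ {x} x∈∁Pj → decidable-stable (x ∈? K) λ x∉K →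
      Subset.x∈∁p⇒x∉p x∈∁Pj (∁K⊆Pj (Subset.x∉p⇒x∈∁p (x∉K ∘ fromList⁻ K)))))

  ·-id : ∀ {k} (x : Vec (Fin n) k) → Perm.id · x ≡ x
  ·-id = Vec.map-id

  ·-∘ : ∀ {k} (σ τ : Permutation′ n) (x : Vec (Fin n) k) → (σ ∘ₚ τ) · x ≡ τ · (σ · x)
  ·-∘ σ τ = Vec.map-∘ (τ ⟨$⟩ʳ_) (σ ⟨$⟩ʳ_)

  ·-fixed : ∀ {k} (σ : Permutation′ n) (x : Vec (Fin n) k) →
            (∀ i → σ ⟨$⟩ʳ Vec.lookup x i ≡ Vec.lookup x i) → σ · x ≡ x
  ·-fixed σ []      _     = refl
  ·-fixed σ (u ∷ x) fixed with σ ⟨$⟩ʳ u | fixed zero | σ · x | ·-fixed σ x (fixed ∘ suc)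
  ... | _ | refl | _ | refl = refl

  ·-fixed⁻¹ : ∀ {k} (σ : Permutation′ n) {x : Vec (Fin n) k} → σ · x ≡ x →
              ∀ i → σ ⟨$⟩ʳ Vec.lookup x i ≡ Vec.lookup x i
  ·-fixed⁻¹ σ {x} eq i =
    trans (sym (Vec.lookup-map i (σ ⟨$⟩ʳ_) x)) (cong (λ y → Vec.lookup y i) eq)

  -- The group action on the gates of a rigid symmetric circuit.

  module _ {𝔹 : Basis} {τ : Vocabulary} {q n : ℕ} (C : Circuit 𝔹 τ q n) where
    open Circuit C

    -- By acyclicity the transitive closure is a strict order, which on a finite set is
    -- well-founded.
    Wire-wellFounded : WellFounded Wire
    Wire-wellFounded = Closure.wellFounded⁻ Wire (spo-wellFounded {_⊏_ = TransClosure Wire} (record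
      { isEquivalence = isEquivalence
      ; irrefl        = λ { refl → acyclic _ }
      ; trans         = Closure.transitive Wire
      ; <-resp-≈      = (λ { refl p → p }) , (λ { refl p → p })
      }))

    -- `Λ` takes a proof of the label as argument; equality proofs being unique, the tuple does not
    -- depend on it.
    Λ-cong : ∀ {R g h} → g ≡ h → (e : label g ≡ rel R) (e′ : label h ≡ rel R) → Λ R g e ≡ Λ R h e′
    Λ-cong refl e e′ = cong (Λ _ _) (≡-irrelevant e e′)

    Induces-resp : ∀ {σ σ′ π} → σ ≈ σ′ → Induces C σ π → Induces C σ′ π
    Induces-resp σ≈σ′ ind = record
      { wires     = wires
      ; outputs   = λ x → trans (outputs x) (cong Ω (Vec.map-cong σ≈σ′ x))
      ; labels    = labels
      ; relations = λ R g e e′ → trans (sym (Vec.map-cong σ≈σ′ (Λ R g e))) (relations R g e e′)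
      }
      where open Induces ind

    Induces-id : Induces C Perm.id Perm.id
    Induces-id = record
      { wires     = λ g h → mk⇔ (λ w → w) (λ w → w)
      ; outputs   = λ x → cong Ω (sym (·-id x))
      ; labels    = λ _ → refl
      ; relations = λ R g e e′ → trans (·-id _) (Λ-cong refl e e′)
      }

    Induces-∘ : ∀ {σ σ′ π π′} → Induces C σ π → Induces C σ′ π′ → Induces C (σ ∘ₚ σ′) (π ∘ₚ π′)
    Induces-∘ {σ} {σ′} {π} {π′} ind ind′ = record
      { wires     = λ g h → mk⇔
          (Equivalence.to (I′.wires _ _) ∘ Equivalence.to (I.wires g h))
          (Equivalence.from (I.wires g h) ∘ Equivalence.from (I′.wires _ _))
      ; outputs   = λ x → trans (cong (π′ ⟨$⟩ʳ_) (I.outputs x))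
          (trans (I′.outputs (σ · x)) (cong Ω (sym (·-∘ σ σ′ x))))
      ; labels    = λ g → trans (I.labels g) (I′.labels _)
      ; relations = λ R g e e′ → let e″ = trans (sym (I.labels g)) e in
          trans (·-∘ σ σ′ (Λ R g e))
            (trans (cong (σ′ ·_) (I.relations R g e e″)) (I′.relations R _ e″ e′))
      }
      where
      module I  = Induces ind
      module I′ = Induces ind′

    module _ (rigid : Rigid C) where

      Twins⇒≡ : ∀ {g h} → Twins C g h → g ≡ h
      Twins⇒≡ {g} {h} twins = decidable-stable (g ≟ h) λ g≢h → rigid (g , h , g≢h , twins)

      -- Induction along the wires: if two automorphisms induced by `σ` agree on the children of
      -- `g`, they send `g` to twins, which rigidity identifies.
      Induces-unique : ∀ {σ π π′} → Induces C σ π → Induces C σ π′ →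
                       ∀ g → π ⟨$⟩ʳ g ≡ π′ ⟨$⟩ʳ g
      Induces-unique {σ} {π} {π′} ind ind′ g = go g (Wire-wellFounded g)
        where
        outputs⇒ : ∀ {π π′} → Induces C σ π → Induces C σ π′ → ∀ g x →
                   Ω x ≡ π ⟨$⟩ʳ g → Ω x ≡ π′ ⟨$⟩ʳ g
        outputs⇒ {π} {π′} ind ind′ g x eq = trans (cong Ω x≡σy)
          (trans (sym (Induces.outputs ind′ y)) (cong (π′ ⟨$⟩ʳ_) Ωy≡g))
          where
          y = flip σ · x
          x≡σy : x ≡ σ · y
          x≡σy = trans (sym (·-id x)) (trans (Vec.map-cong (λ _ → sym (inverseʳ σ)) x)
                                              (·-∘ (flip σ) σ x))
          Ωy≡g : Ω y ≡ g
          Ωy≡g = ⟨$⟩ʳ-injective π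
            (trans (Induces.outputs ind y) (trans (cong Ω (sym x≡σy)) eq))
        children⇒ : ∀ {π π′} → Induces C σ π → Induces C σ π′ → ∀ g →
                    (∀ {h} → Wire h g → π ⟨$⟩ʳ h ≡ π′ ⟨$⟩ʳ h) → ∀ k →
                    Wire k (π ⟨$⟩ʳ g) → Wire k (π′ ⟨$⟩ʳ g)
        children⇒ {π} {π′} ind ind′ g agree k w = subst (λ k → Wire k (π′ ⟨$⟩ʳ g))
          (trans (sym (agree w′)) (inverseʳ π)) (Equivalence.to (Induces.wires ind′ _ _) w′)
          where
          w′ : Wire (π ⟨$⟩ˡ k) g
          w′ = Equivalence.from (Induces.wires ind _ _)
            (subst (λ k → Wire k (π ⟨$⟩ʳ g)) (sym (inverseʳ π)) w)
        go : ∀ g → Acc Wire g → π ⟨$⟩ʳ g ≡ π′ ⟨$⟩ʳ g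
        go g (acc rec) = Twins⇒≡ (record
          { same-label    = trans (sym (Induces.labels ind g)) (Induces.labels ind′ g)
          ; same-tuple    = λ R e e′ → let e₀ = trans (Induces.labels ind g) e in
              trans (sym (Induces.relations ind R g e₀ e)) (Induces.relations ind′ R g e₀ e′)
          ; same-outputs  = λ x → mk⇔ (outputs⇒ {π} {π′} ind ind′ g x)
                                      (outputs⇒ {π′} {π} ind′ ind g x)
          ; same-children = λ k → mk⇔ (children⇒ {π} {π′} ind ind′ g agree k)
                                      (children⇒ {π′} {π} ind′ ind g (sym ∘ agree) k)
          })
          where
          agree : ∀ {h} → Wire h g → π ⟨$⟩ʳ h ≡ π′ ⟨$⟩ʳ h
          agree w = go _ (rec w)

      module _ (sym-C : Symmetric C) where

        -- Symmetry merely chooses some automorphism for each `σ`. Uniqueness makes these choices a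
        -- group action, here and in the next lemmas.
        act-cong : ∀ {σ σ′} → σ ≈ σ′ → ∀ g → act C sym-C σ g ≡ act C sym-C σ′ g
        act-cong {σ} {σ′} σ≈σ′ = Induces-unique {σ′} {proj₁ (sym-C σ)} {proj₁ (sym-C σ′)}
          (Induces-resp {σ} {σ′} {proj₁ (sym-C σ)} σ≈σ′ (proj₂ (sym-C σ))) (proj₂ (sym-C σ′))

        act-id : ∀ g → act C sym-C Perm.id g ≡ g
        act-id = Induces-unique {Perm.id} {proj₁ (sym-C Perm.id)} {Perm.id}
          (proj₂ (sym-C Perm.id)) Induces-id

        act-∘ : ∀ σ σ′ g → act C sym-C (σ ∘ₚ σ′) g ≡ act C sym-C σ′ (act C sym-C σ g)
        act-∘ σ σ′ = Induces-unique {σ ∘ₚ σ′} {proj₁ (sym-C (σ ∘ₚ σ′))}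
          {proj₁ (sym-C σ) ∘ₚ proj₁ (sym-C σ′)} (proj₂ (sym-C (σ ∘ₚ σ′)))
          (Induces-∘ {σ} {σ′} {proj₁ (sym-C σ)} {proj₁ (sym-C σ′)}
            (proj₂ (sym-C σ)) (proj₂ (sym-C σ′)))

        act-flip : ∀ σ g → act C sym-C (flip σ) (act C sym-C σ g) ≡ g
        act-flip σ g = trans (sym (act-∘ σ (flip σ) g))
          (trans (act-cong {σ ∘ₚ flip σ} {Perm.id} (λ _ → inverseˡ σ) g) (act-id g))

        act-wires : ∀ σ {h g} → Wire h g → Wire (act C sym-C σ h) (act C sym-C σ g)
        act-wires σ = Equivalence.to (Induces.wires (proj₂ (sym-C σ)) _ _)

        Stab-isSubgroup : ∀ g → IsSubgroup (Stab C sym-C g)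
        Stab-isSubgroup g = record
          { resp        = λ {σ} {σ′} σ≈σ′ → trans (sym (act-cong {σ} {σ′} σ≈σ′ g))
          ; id∈         = act-id g
          ; ∘-closed    = λ {σ} {σ′} σg σ′g →
              trans (act-∘ σ σ′ g) (trans (cong (act C sym-C σ′) σg) σ′g)
          ; flip-closed = λ {σ} σg →
              trans (cong (act C sym-C (flip σ)) (sym σg)) (act-flip σ g)
          }

        private
          module G (g : Gate) = Subgroup (Stab-isSubgroup g)

        -- Permutations in distinct cosets of the stabiliser send `g` to distinct gates of its
        -- orbit.
        Stab-index : ∀ {s} → MaxOrbit C sym-C s → ∀ g → G.Index≤ g s
        Stab-index (bound , _) g {N} f separated with bound g
        ... | k , (S , S⇔Orb , refl) , k≤s = ℕ.≤-trans
          (subst (_≤ ∣ S ∣) (length-tabulate orbit)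
            (length≤∣p∣ S (Unique.tabulate⁺ orbit-injective) λ x∈ →
              let i , x≡ = ∈-tabulate⁻ {f = orbit} x∈ in
              Equivalence.from (S⇔Orb _) (f i , sym x≡)))
          k≤s
          where
          orbit : Fin N → Gate
          orbit i = act C sym-C (f i) g
          orbit-injective : ∀ {i j} → orbit i ≡ orbit j → i ≡ j
          orbit-injective {i} {j} eq = decidable-stable (i ≟ j) λ i≢j →
            separated i≢j (trans (act-∘ (f i) (flip (f j)) g)
              (trans (cong (act C sym-C (flip (f j))) eq) (act-flip (f j) g)))

        -- Small supports for all gates.

        module _ {s d : ℕ} (s-max : MaxOrbit C sym-C s) (s<2^d : s < 2 ^ d)
                 (room : d * 3 + d * (d * 3 + 2) + 2 ≤ n) where

          Supported : Gate → Set
          Supported g = ∃[ E ] length E ≤ d * 3 × G.Equivalent g E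

          -- `T` is to hold a support of a child, of length `d * 3`, and the two exchanged points;
          -- `room` pays for `E`, for `d` such lists and for two more points.
          separable⇒⊥ : ∀ {g E} → length E ≤ d * 3 →
            ¬ (∀ u v → u ∉ E → v ∉ E → u ≢ v →
                 ∃[ T ] length T ≤ d * 3 + 2 × G.Separates g T (transpose u v))
          separable⇒⊥ {g} |E| = G.separable⇒large g {d = d} (Stab-index s-max g) s<2^d
            (ℕ.≤-trans (ℕ.+-monoˡ-≤ 2 (ℕ.+-monoˡ-≤ (d * (d * 3 + 2)) |E|)) room)

          -- The transposition of u and v moves g only when u or v occurs in x.
          tuple⇒⊥ : ∀ {g E k} (x : Vec (Fin n) k) →
            (∀ {σ} → σ · x ≡ x → Stab C sym-C g σ) → (∀ {σ} → Stab C sym-C g σ → σ · x ≡ x) →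
            length E ≤ d * 3 → ¬ G.Inequivalent g E
          tuple⇒⊥ {g} {E} x fixed⇒ ⇒fixed |E| inequivalent = separable⇒⊥ |E|
            λ u v u∉E v∉E u≢v → u ∷ v ∷ [] , ℕ.m≤n+m 2 (d * 3) ,
              λ ρ ρ′ ρ-fixes ρ′-fixes h →
                -- `π` exchanges `u` and `v`. If it fixes `g`, it fixes the entries of `x`, so
                -- neither point occurs there, and the transposition fixes `x` and `g` as well.
                let π = ρ ∘ₚ transpose u v ∘ₚ ρ′
                    moved : ∀ {y z} → y ∈ u ∷ v ∷ [] → z ∈ u ∷ v ∷ [] → y ≢ z →
                      transpose u v ⟨$⟩ʳ y ≡ z → ∀ i → Vec.lookup x i ≢ y
                    moved = λ {y} {z} y∈ z∈ y≢z τy≡z i xi≡y → y≢z (trans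
                      (sym (subst (λ y → π ⟨$⟩ʳ y ≡ y) xi≡y (·-fixed⁻¹ π (⇒fixed {π} h) i)))
                      (trans (cong (λ y → ρ′ ⟨$⟩ʳ (transpose u v ⟨$⟩ʳ y)) (ρ-fixes y∈))
                        (trans (cong (ρ′ ⟨$⟩ʳ_) τy≡z) (ρ′-fixes z∈))))
                in inequivalent u v u∉E v∉E u≢v (fixed⇒ {transpose u v} (·-fixed (transpose u v) x λ i →
                     transpose-other
                       (moved (here refl) (there (here refl)) u≢v (transpose-left u v) i)
                       (moved (there (here refl)) (here refl) (u≢v ∘ sym) (transpose-right u v) i)))

          output⇒⊥ : ∀ {g E} x → Ω x ≡ g → length E ≤ d * 3 → ¬ G.Inequivalent g E
          output⇒⊥ {g} x refl = tuple⇒⊥ x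
            (λ {σ} σx≡x → trans (Induces.outputs (proj₂ (sym-C σ)) x) (cong Ω σx≡x))
            (λ {σ} σg≡g → Ω-injective _ _
              (trans (sym (Induces.outputs (proj₂ (sym-C σ)) x)) σg≡g))

          relational⇒⊥ : ∀ {g E R} → label g ≡ rel R → length E ≤ d * 3 → ¬ G.Inequivalent g E
          relational⇒⊥ {g} {R = R} e = tuple⇒⊥ (Λ R g e)
            (λ {σ} σx≡x → let e′ = trans (sym (Induces.labels (proj₂ (sym-C σ)) g)) e in
              Λ-injective R _ g e′ e
                (trans (sym (Induces.relations (proj₂ (sym-C σ)) R g e e′)) σx≡x))
            (λ {σ} σg≡g → let e′ = trans (sym (Induces.labels (proj₂ (sym-C σ)) g)) e in
              trans (Induces.relations (proj₂ (sym-C σ)) R g e e′) (Λ-cong σg≡g e′ e))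

          constant-supported : ∀ {g b} → label g ≡ const b → Supported g
          constant-supported {g} {b} e = [] , z≤n , λ u v _ _ → const-unique b _ g
            (trans (sym (Induces.labels (proj₂ (sym-C (transpose u v))) g)) e) e

          module Internal {g : Gate}
                   (no-tuple : ∀ {R : Fin (Vocabulary.size τ)} → label g ≢ rel R)
                   (no-output : ∀ (x : Vec (Fin n) q) → Ω x ≢ g) where

            -- Were all children moved to children, `g` and its image would have the same children,
            -- the transposition being an involution. With neither tuple nor output to tell them
            -- apart, rigidity would give `u ~ v`.
            moved-child : ∀ {u v} → ¬ G._~_ g u v →
              ∃[ h ] Wire h g × ¬ Wire (act C sym-C (transpose u v) h) g
            moved-child {u} {v} u≁v with any? (λ h →
              wire? h g ×-dec ¬? (wire? (act C sym-C (transpose u v) h) g))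
            ... | yes found = found
            ... | no none   = contradiction (sym (Twins⇒≡ (record
              { same-label    = I.labels g
              ; same-tuple    = λ R e → contradiction e no-tuple
              ; same-outputs  = λ x → mk⇔ (λ Ωx≡g → contradiction Ωx≡g (no-output x))
                  (λ Ωx≡swapg → contradiction
                    (trans (sym (I.outputs x)) (trans (cong swap Ωx≡swapg) (swap² g)))
                    (no-output (transpose u v · x)))
              ; same-children = λ k → mk⇔
                  (λ w → subst (λ k → Wire k (swap g)) (swap² k) (act-wires (transpose u v) (closed w)))
                  (λ w → subst (λ k → Wire k g) (swap² k)
                    (closed (subst (Wire (swap k)) (swap² g) (act-wires (transpose u v) w))))
              }))) u≁v
              where
              module I = Induces (proj₂ (sym-C (transpose u v)))
              swap : Gate → Gate
              swap = act C sym-C (transpose u v)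
              swap² : ∀ k → swap (swap k) ≡ k
              swap² k = trans (sym (act-∘ (transpose u v) (transpose u v) k))
                (trans (act-cong {transpose u v ∘ₚ transpose u v} {Perm.id} involutive k) (act-id k))
                where
                involutive : transpose u v ∘ₚ transpose u v ≈ Perm.id
                involutive x = trans (cong (transpose u v ⟨$⟩ʳ_) (transpose-sym u v x))
                                     (inverseʳ (transpose u v))
              closed : ∀ {h} → Wire h g → Wire (swap h) g
              closed {h} w = decidable-stable (wire? (swap h) g) λ ¬w → none (h , w , ¬w)

            -- Permutations fixing the support of h together with u and v fix
            -- both h and its image under the transposition of u and v.
            child-separates : ∀ {u v h} → Wire h g → ¬ Wire (act C sym-C (transpose u v) h) g →
              ∀ T → G.Equivalent h T → G.Separates g (T ++ u ∷ v ∷ []) (transpose u v)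
            child-separates {u} {v} {h} w ¬w T equivalent ρ ρ′ ρ-fixes ρ′-fixes fixes-g =
              ¬w (subst (λ k → Wire k g) moved (subst (Wire _) fixes-g (act-wires π w)))
              where
              t = transpose u v
              π = ρ ∘ₚ t ∘ₚ ρ′
              _·g_ : Permutation′ n → Gate → Gate
              _·g_ = act C sym-C
              ρ-h : ρ ·g h ≡ h
              ρ-h = G.generated h T equivalent {ρ} (ρ-fixes ∘ ∈-++⁺ˡ)
              -- `t` maps `T` into `T` with `u` and `v` added, where `ρ′` is the identity. So the
              -- conjugate of `ρ′` by `t` fixes `T` and hence `h`; that is, `ρ′` fixes `t ·g h`.
              conj-fixes : Fixes T (t ∘ₚ ρ′ ∘ₚ flip t)
              conj-fixes {z} z∈T = trans (cong (t ⟨$⟩ˡ_) fixed) (inverseˡ t)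
                where
                by-cases : Dec (z ≡ u) → Dec (z ≡ v) → t ⟨$⟩ʳ z ∈ T ++ u ∷ v ∷ []
                by-cases (yes refl) _          = subst (_∈ T ++ u ∷ v ∷ [])
                  (sym (transpose-left u v)) (∈-++⁺ʳ T (there (here refl)))
                by-cases (no _)     (yes refl) = subst (_∈ T ++ u ∷ v ∷ [])
                  (sym (transpose-right u v)) (∈-++⁺ʳ T (here refl))
                by-cases (no z≢u)   (no z≢v)   = subst (_∈ T ++ u ∷ v ∷ [])
                  (sym (transpose-other z≢u z≢v)) (∈-++⁺ˡ z∈T)
                fixed : ρ′ ⟨$⟩ʳ (t ⟨$⟩ʳ z) ≡ t ⟨$⟩ʳ z
                fixed = ρ′-fixes (by-cases (z ≟ u) (z ≟ v))
              ρ′-swap : ρ′ ·g (t ·g h) ≡ t ·g h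
              ρ′-swap = ⟨$⟩ʳ-injective (proj₁ (sym-C (flip t)))
                (trans (sym (trans (act-∘ t (ρ′ ∘ₚ flip t) h) (act-∘ ρ′ (flip t) (t ·g h))))
                  (trans (G.generated h T equivalent {t ∘ₚ ρ′ ∘ₚ flip t} conj-fixes)
                    (sym (act-flip t h))))
              moved : π ·g h ≡ t ·g h
              moved = trans (act-∘ ρ (t ∘ₚ ρ′) h) (trans (cong ((t ∘ₚ ρ′) ·g_) ρ-h)
                (trans (act-∘ t ρ′ h) ρ′-swap))

          -- The bound does not deteriorate along the wires: supports of children only refute the
          -- inequivalent case at an operation gate and do not enter its own support.
          supported : ∀ g → Supported g
          supported g = go g (Wire-wellFounded g)
            where
            go : ∀ g → Acc Wire g → Supported g
            go g (acc rec) with G.dichotomy g (λ σ → act C sym-C σ g ≟ g) {d = d}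
                                  (Stab-index s-max g) s<2^d
            ... | inj₁ equivalent = equivalent
            ... | inj₂ (E , |E| , inequivalent) with label g in eq
            ...   | const b = constant-supported eq
            ...   | rel R   = contradiction inequivalent (relational⇒⊥ eq |E|)
            ...   | op i    = contradiction
              (λ u v u∉E v∉E u≢v →
                let h , w , ¬w = moved-child (inequivalent u v u∉E v∉E u≢v)
                    T , |T| , equivalent = go h (rec w)
                in T ++ u ∷ v ∷ [] ,
                   ℕ.≤-trans (ℕ.≤-reflexive (length-++ T)) (ℕ.+-monoˡ-≤ 2 |T|) ,
                   child-separates w ¬w T equivalent)
              (separable⇒⊥ |E|)
              where
              -- An operation gate carries no relational tuple; were it an output, its index tuple
              -- would already give the contradiction.
              open Internal {g}
                (λ e → contradiction (trans (sym eq) e) λ ())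
                (λ x Ωx≡g → output⇒⊥ x Ωx≡g |E| inequivalent)

          -- For `b` off the support `E` of `g`, the points not equivalent to `b` form a set `K`
          -- inside `E`. It supports `g`, which bounds the norm, and exchanging its points with the
          -- class of `b` bounds `d ^ length K`.
          SP-norm-bound : suc (d * 3 * (2 + d) + d * 3) + d ≤ n → ∀ {w} → CircuitSP C sym-C w →
                          ∃[ k ] w ≤ k × d ^ k ≤ s
          SP-norm-bound room′ (_ , g , P , isSP , norm) with supported g
          ... | E , |E| , equivalent with fresh E (ℕ.≤-trans (s≤s |E|)
                  (ℕ.≤-trans (s≤s (ℕ.≤-trans (ℕ.m≤n+m _ _) (ℕ.m≤m+n _ d))) room′))
          ...   | b , b∉E = length K ,
            SP-norm-≤ {P = P} unique (λ b∈K → ∈K⇒≁ b∈K (G.~-refl g b))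
              (λ {σ} → G.generated g K (λ _ _ u∉K v∉K →
                G.~-trans g (∉K⇒~ u∉K) (G.~-sym g (∉K⇒~ v∉K))) {σ}) isSP norm ,
            G.exchange g d b K unique ∈K⇒≁ ∉K⇒~ (Stab-index s-max g)
              (ℕ.≤-trans (ℕ.+-monoˡ-≤ d (s≤s (ℕ.+-mono-≤ (ℕ.*-monoˡ-≤ (2 + d) |K|) |K|))) room′)
            where
            ~b? : ∀ x → Dec (G._~_ g x b)
            ~b? x = act C sym-C (transpose x b) g ≟ g
            K : List (Fin n)
            K = filter (¬? ∘ ~b?) (allFin n)
            unique : Unique K
            unique = Unique.filter⁺ (¬? ∘ ~b?) (Unique.allFin⁺ n)
            ∈K⇒≁ : ∀ {x} → x ∈ K → ¬ G._~_ g x b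
            ∈K⇒≁ x∈K = proj₂ (∈-filter⁻ (¬? ∘ ~b?) {xs = allFin n} x∈K)
            ∉K⇒~ : ∀ {x} → x ∉ K → G._~_ g x b
            ∉K⇒~ {x} x∉K = decidable-stable (~b? x) λ x≁b →
              x∉K (∈-filter⁺ (¬? ∘ ~b?) (∈-allFin x) x≁b)
            |K| : length K ≤ d * 3
            |K| = ℕ.≤-trans (Unique-⊆⇒length≤ unique λ {x} x∈K →
              decidable-stable (x ∈? E) λ x∉E → ∈K⇒≁ x∈K (equivalent x b x∉E b∉E)) |E|

-- Numerical estimates, and the passage from cuts to natural numbers.

module Estimates where
  open import Data.Integer.Base as ℤ using (+_; _⊖_)
  import Data.Integer.Properties as ℤ
  open import Data.Nat.Base using (ℕ; zero; suc; _+_; _*_; _∸_; _^_; _≤_; _<_; z≤n; s≤s; NonZero;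
                                   >-nonZero)
  import Data.Nat.Properties as ℕ
  open import Data.Nat.Tactic.RingSolver using (solve-∀)
  open import Data.Product using (∃-syntax; _×_; _,_)
  open import Data.Rational.Base as ℚ using (ℚ; 0ℚ; 1ℚ)
  import Data.Rational.Properties as ℚ
  import Data.Rational.Unnormalised.Base as ℚᵘ
  import Data.Rational.Unnormalised.Properties as ℚᵘ
  open import Data.Sum.Base using (inj₁; inj₂)
  open import Relation.Binary.PropositionalEquality
    using (_≡_; refl; sym; trans; cong; cong₂; subst; subst₂)
  open import Relation.Nullary using (¬_; yes; no; contradiction)
  open import Relation.Nullary.Decidable using (from-yes)

  open import Defs using (cut; ⅔; fromℕ; 0ℝ; log; log-pos)
  import Defs as R
  open Circuits

  bracket : (f : ℕ → ℕ) {m : ℕ} → f 0 ≤ m → ∀ N → m < f N → ∃[ c ] f c ≤ m × m < f (suc c)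
  bracket f f0≤m zero    m<f0 = contradiction f0≤m (ℕ.<⇒≱ m<f0)
  bracket f {m} f0≤m (suc N) m<f with f N ℕ.≤? m
  ... | yes fN≤m = N , fN≤m , m<f
  ... | no fN≰m  = bracket f f0≤m N (ℕ.≰⇒> fN≰m)

  n<2^n : ∀ k → k < 2 ^ k
  n<2^n zero    = s≤s z≤n
  n<2^n (suc k) = ℕ.≤-trans (ℕ.+-mono-≤ (ℕ.m^n>0 2 k) (n<2^n k))
    (ℕ.≤-reflexive (cong (_+_ (2 ^ k)) (sym (ℕ.+-identityʳ _))))

  log-floor : ∀ k → .{{NonZero k}} → ∃[ a ] 2 ^ a ≤ k × k < 2 ^ suc a
  log-floor k@(suc _) = bracket (2 ^_) (s≤s z≤n) k (n<2^n k)

  cube-root : ∀ k → ∃[ c ] c ^ 3 ≤ k × k < suc c ^ 3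
  cube-root k = bracket (_^ 3) z≤n (suc k) (ℕ.m≤m*n (suc k) (suc k ^ 2) {{ℕ.m^n≢0 (suc k) 2}})

  ^-distribʳ-* : ∀ x y k → (x * y) ^ k ≡ x ^ k * y ^ k
  ^-distribʳ-* x y zero    = refl
  ^-distribʳ-* x y (suc k) = trans (cong (x * y *_) (^-distribʳ-* x y k))
                                   (ℕ.[m*n]*[o*p]≡[m*o]*[n*p] x y _ _)

  ^-swap : ∀ x j k → (x ^ j) ^ k ≡ (x ^ k) ^ j
  ^-swap x j k = trans (ℕ.^-*-assoc x j k)
    (trans (cong (x ^_) (ℕ.*-comm j k)) (sym (ℕ.^-*-assoc x k j)))

  2^-cancel-< : ∀ a b → 2 ^ a < 2 ^ b → a < b
  2^-cancel-< a b lt = ℕ.≰⇒> λ b≤a → ℕ.<⇒≱ lt (ℕ.^-monoʳ-≤ 2 b≤a)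

  2^-cancel-≤ : ∀ a b → 2 ^ a ≤ 2 ^ b → a ≤ b
  2^-cancel-≤ a b le = ℕ.≮⇒≥ λ b<a → ℕ.<⇒≱ (ℕ.^-monoʳ-< 2 (s≤s (s≤s z≤n)) b<a) le

  quadratic≤cubic : ∀ a b e c → .{{NonZero c}} → a + b + e ≤ c → a * (c * c) + b * c + e ≤ c ^ 3
  quadratic≤cubic a b e c coefficients = begin
    a * (c * c) + b * c + e                   ≤⟨ ℕ.+-mono-≤
      (ℕ.+-monoʳ-≤ (a * (c * c)) (ℕ.*-monoʳ-≤ b (ℕ.m≤m*n c c)))
      (ℕ.m≤m*n e (c * c) {{ℕ.m*n≢0 c c}}) ⟩
    a * (c * c) + b * (c * c) + e * (c * c)   ≡⟨ identity a b e (c * c) ⟩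
    (a + b + e) * (c * c)                     ≤⟨ ℕ.*-monoˡ-≤ (c * c) coefficients ⟩
    c * (c * c)                               ≡⟨ cong (λ z → c * (c * z)) (sym (ℕ.*-identityʳ c)) ⟩
    c ^ 3                                     ∎
    where
    open ℕ.≤-Reasoning
    identity : ∀ a b e x → a * x + b * x + e * x ≡ (a + b + e) * x
    identity = solve-∀

  -- `2 ^ 20` is just above `100 ^ 3`.
  cube-root-large : ∀ {n c} → 2 ^ 20 ≤ n → n < suc c ^ 3 → 100 ≤ c
  cube-root-large {n} {c} n-large n< = ℕ.≮⇒≥ λ c<100 → ℕ.<⇒≱ n<
    (ℕ.≤-trans (ℕ.^-monoˡ-≤ 3 c<100) (ℕ.≤-trans (from-yes (100 ^ 3 ℕ.≤? 2 ^ 20)) n-large))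

  -- Provides the hypothesis `room` on supports for `d = 2 + c`, as `room₂` does for `room′`. The
  -- constants 44 and 58 are the sums of the coefficients of the expanded quadratics.
  room₁ : ∀ {n c} → 100 ≤ c → c ^ 3 ≤ n →
          (2 + c) * 3 + (2 + c) * ((2 + c) * 3 + 2) + 2 ≤ n
  room₁ {c = c} c-large c³≤n = ℕ.≤-trans (ℕ.≤-reflexive (identity c))
    (ℕ.≤-trans (quadratic≤cubic 3 17 24 c {{>-nonZero (ℕ.≤-trans (s≤s z≤n) c-large)}}
      (ℕ.≤-trans (from-yes (44 ℕ.≤? 100)) c-large)) c³≤n)
    where
    identity : ∀ c → (2 + c) * 3 + (2 + c) * ((2 + c) * 3 + 2) + 2 ≡ 3 * (c * c) + 17 * c + 24
    identity = solve-∀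

  room₂ : ∀ {n c} → 100 ≤ c → c ^ 3 ≤ n →
          suc ((2 + c) * 3 * (4 + c) + (2 + c) * 3) + (2 + c) ≤ n
  room₂ {c = c} c-large c³≤n = ℕ.≤-trans (ℕ.≤-reflexive (identity c))
    (ℕ.≤-trans (quadratic≤cubic 3 22 33 c {{>-nonZero (ℕ.≤-trans (s≤s z≤n) c-large)}}
      (ℕ.≤-trans (from-yes (58 ℕ.≤? 100)) c-large)) c³≤n)
    where
    identity : ∀ c → suc ((2 + c) * 3 * (4 + c) + (2 + c) * 3) + (2 + c) ≡ 3 * (c * c) + 22 * c + 33
    identity = solve-∀

  -- Fractions of natural numbers, and their powers.

  fromℚᵘ-mono-≤ : ∀ {p q} → p ℚᵘ.≤ q → ℚ.fromℚᵘ p ℚ.≤ ℚ.fromℚᵘ q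
  fromℚᵘ-mono-≤ {p} {q} p≤q = ℚ.toℚᵘ-cancel-≤
    (ℚᵘ.≤-respˡ-≃ (ℚᵘ.≃-sym (ℚ.toℚᵘ-fromℚᵘ p)) (ℚᵘ.≤-respʳ-≃ (ℚᵘ.≃-sym (ℚ.toℚᵘ-fromℚᵘ q)) p≤q))

  fromℚᵘ-mono-< : ∀ {p q} → p ℚᵘ.< q → ℚ.fromℚᵘ p ℚ.< ℚ.fromℚᵘ q
  fromℚᵘ-mono-< {p} {q} p<q = ℚ.toℚᵘ-cancel-<
    (ℚᵘ.<-respˡ-≃ (ℚᵘ.≃-sym (ℚ.toℚᵘ-fromℚᵘ p)) (ℚᵘ.<-respʳ-≃ (ℚᵘ.≃-sym (ℚ.toℚᵘ-fromℚᵘ q)) p<q))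

  fromℚᵘ-cancel-< : ∀ {p q} → ℚ.fromℚᵘ p ℚ.< ℚ.fromℚᵘ q → p ℚᵘ.< q
  fromℚᵘ-cancel-< {p} {q} p<q =
    ℚᵘ.<-respˡ-≃ (ℚ.toℚᵘ-fromℚᵘ p) (ℚᵘ.<-respʳ-≃ (ℚ.toℚᵘ-fromℚᵘ q) (ℚ.toℚᵘ-mono-< p<q))

  fromℚᵘ-* : ∀ p q → ℚ.fromℚᵘ p ℚ.* ℚ.fromℚᵘ q ≡ ℚ.fromℚᵘ (p ℚᵘ.* q)
  fromℚᵘ-* p q = ℚ.toℚᵘ-injective
    (ℚᵘ.≃-trans (ℚ.toℚᵘ-homo-* (ℚ.fromℚᵘ p) (ℚ.fromℚᵘ q))
    (ℚᵘ.≃-trans (ℚᵘ.*-cong (ℚ.toℚᵘ-fromℚᵘ p) (ℚ.toℚᵘ-fromℚᵘ q))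
                (ℚᵘ.≃-sym (ℚ.toℚᵘ-fromℚᵘ (p ℚᵘ.* q)))))

  frac : ℕ → ℕ → ℚ
  frac a c = + a ℚ./ suc c

  frac-≤ : ∀ a c b d → a * suc d ≤ b * suc c → frac a c ℚ.≤ frac b d
  frac-≤ a c b d le = fromℚᵘ-mono-≤ {ℚᵘ.mkℚᵘ (+ a) c} {ℚᵘ.mkℚᵘ (+ b) d}
    (ℚᵘ.*≤* (subst₂ ℤ._≤_ (ℤ.pos-* a (suc d)) (ℤ.pos-* b (suc c)) (ℤ.+≤+ le)))

  frac-< : ∀ a c b d → a * suc d < b * suc c → frac a c ℚ.< frac b d
  frac-< a c b d lt = fromℚᵘ-mono-< {ℚᵘ.mkℚᵘ (+ a) c} {ℚᵘ.mkℚᵘ (+ b) d}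
    (ℚᵘ.*<* (subst₂ ℤ._<_ (ℤ.pos-* a (suc d)) (ℤ.pos-* b (suc c)) (ℤ.+<+ lt)))

  frac-<⁻¹ : ∀ a c b d → frac a c ℚ.< frac b d → a * suc d < b * suc c
  frac-<⁻¹ a c b d lt = ℤ.drop‿+<+ (subst₂ ℤ._<_ (sym (ℤ.pos-* a (suc d))) (sym (ℤ.pos-* b (suc c)))
    (ℚᵘ.drop-*<* (fromℚᵘ-cancel-< {ℚᵘ.mkℚᵘ (+ a) c} {ℚᵘ.mkℚᵘ (+ b) d} lt)))

  frac-* : ∀ a c b d → frac a c ℚ.* frac b d ≡ frac (a * b) (d + c * suc d)
  frac-* a c b d = trans (fromℚᵘ-* (ℚᵘ.mkℚᵘ (+ a) c) (ℚᵘ.mkℚᵘ (+ b) d))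
    (cong (ℚ._/ suc (d + c * suc d)) (sym (ℤ.pos-* a b)))

  frac-nonNeg : ∀ a c → 0ℚ ℚ.≤ frac a c
  frac-nonNeg a c = frac-≤ 0 0 a c z≤n

  frac-≤-⊖ : ∀ a c b d e → a * suc e + d * suc c ≤ b * suc c → frac a c ℚ.≤ (b ⊖ d) ℚ./ suc e
  frac-≤-⊖ a c b d e le = subst (λ i → frac a c ℚ.≤ i ℚ./ suc e) (sym (ℤ.⊖-≥ d≤b))
    (frac-≤ a c (b ∸ d) e (begin
      a * suc e                                   ≤⟨ ℕ.m+n≤o⇒m≤o∸n (a * suc e) le ⟩
      b * suc c ∸ d * suc c                     ≡⟨ ℕ.*-distribʳ-∸ (suc c) b d ⟨
      (b ∸ d) * suc c                           ∎))
    where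
    open ℕ.≤-Reasoning
    d≤b : d ≤ b
    d≤b = ℕ.*-cancelʳ-≤ d b (suc c) (ℕ.m+n≤o⇒n≤o (a * suc e) le)

  -- Clearing denominators in 2 ^ k < u / v ≤ 2 ^ ((a - d) / c).
  exponent-≥ : ∀ {a d c k u v} → .{{NonZero v}} → 2 ^ k * v < u → u ^ c * 2 ^ d ≤ 2 ^ a * v ^ c →
               k * c + d ≤ a
  exponent-≥ {a} {d} {c} {k} {u} {v} lt le = 2^-cancel-≤ (k * c + d) a
    (ℕ.*-cancelʳ-≤ _ _ (v ^ c) {{ℕ.m^n≢0 v c}} (begin
      2 ^ (k * c + d) * v ^ c         ≡⟨ cong (_* v ^ c) (ℕ.^-distribˡ-+-* 2 (k * c) d) ⟩
      2 ^ (k * c) * 2 ^ d * v ^ c     ≡⟨ cong (λ z → z * 2 ^ d * v ^ c) (sym (ℕ.^-*-assoc 2 k c)) ⟩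
      (2 ^ k) ^ c * 2 ^ d * v ^ c     ≡⟨ identity ((2 ^ k) ^ c) (2 ^ d) (v ^ c) ⟩
      (2 ^ k) ^ c * v ^ c * 2 ^ d     ≡⟨ cong (_* 2 ^ d) (sym (^-distribʳ-* (2 ^ k) v c)) ⟩
      (2 ^ k * v) ^ c * 2 ^ d         ≤⟨ ℕ.*-monoˡ-≤ (2 ^ d) (ℕ.^-monoˡ-≤ c (ℕ.<⇒≤ lt)) ⟩
      u ^ c * 2 ^ d                   ≤⟨ le ⟩
      2 ^ a * v ^ c                   ∎))
    where
    open ℕ.≤-Reasoning
    identity : ∀ x y z → x * y * z ≡ x * z * y
    identity = solve-∀

  -- Clearing denominators in u / v ≤ n ^ ((a - d) / c) with (a - d) / c ≤ 1 / 3.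
  cube-≤ : ∀ {n a d c u v} → .{{NonZero n}} → .{{NonZero c}} → a * 3 ≤ c + d * 3 →
           u ^ c * n ^ d ≤ n ^ a * v ^ c → u ^ 3 ≤ n * v ^ 3
  -- Otherwise the `c`-th power of the opposite inequality and the cube of `le` would close a strict
  -- cycle.
  cube-≤ {n} {a} {d} {c} {u} {v} exponent le = ℕ.≮⇒≥ λ lt → ℕ.<-irrefl refl (begin-strict
    n ^ (d * 3) * (n * v ^ 3) ^ c        <⟨ ℕ.*-monoʳ-< (n ^ (d * 3)) {{ℕ.m^n≢0 n (d * 3)}}
                                              (ℕ.^-monoˡ-< c lt) ⟩
    n ^ (d * 3) * (u ^ 3) ^ c            ≡⟨ cong₂ _*_ (sym (ℕ.^-*-assoc n d 3)) (^-swap u 3 c) ⟩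
    (n ^ d) ^ 3 * (u ^ c) ^ 3            ≡⟨ ℕ.*-comm ((n ^ d) ^ 3) _ ⟩
    (u ^ c) ^ 3 * (n ^ d) ^ 3            ≡⟨ ^-distribʳ-* (u ^ c) (n ^ d) 3 ⟨
    (u ^ c * n ^ d) ^ 3                  ≤⟨ ℕ.^-monoˡ-≤ 3 le ⟩
    (n ^ a * v ^ c) ^ 3                  ≡⟨ ^-distribʳ-* (n ^ a) (v ^ c) 3 ⟩
    (n ^ a) ^ 3 * (v ^ c) ^ 3            ≡⟨ cong₂ _*_ (ℕ.^-*-assoc n a 3) (^-swap v c 3) ⟩
    n ^ (a * 3) * (v ^ 3) ^ c            ≤⟨ ℕ.*-monoˡ-≤ ((v ^ 3) ^ c) (ℕ.^-monoʳ-≤ n exponent) ⟩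
    n ^ (c + d * 3) * (v ^ 3) ^ c        ≡⟨ cong (_* (v ^ 3) ^ c) (ℕ.^-distribˡ-+-* n c (d * 3)) ⟩
    n ^ c * n ^ (d * 3) * (v ^ 3) ^ c    ≡⟨ identity (n ^ c) (n ^ (d * 3)) ((v ^ 3) ^ c) ⟩
    n ^ (d * 3) * (n ^ c * (v ^ 3) ^ c)  ≡⟨ cong (n ^ (d * 3) *_) (sym (^-distribʳ-* n (v ^ 3) c)) ⟩
    n ^ (d * 3) * (n * v ^ 3) ^ c        ∎)
    where
    open ℕ.≤-Reasoning
    identity : ∀ x y z → x * y * z ≡ y * (x * z)
    identity = solve-∀

  -- The real hypotheses and conclusion in terms of natural numbers.

  ¬cut-1 : ∀ {ε} → ε R.≤ fromℕ 1 → ¬ cut ε 1ℚ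
  ¬cut-1 ε≤1 ε1 = ℚ.<-irrefl refl (ε≤1 1ℚ ε1)

  n-lower-bound : ∀ {ε n} → (0<ε² : 0ℝ R.< ε R.* ε) → ε R.≤ fromℕ 1 →
                  2 R.^ (fromℕ 56 R./ (ε R.* ε) [ 0<ε² ]) R.< fromℕ n → 2 ^ 20 ≤ n
  n-lower-bound {ε} {n} 0<ε² ε≤1 (q , q<n , ¬q) = ℕ.≮⇒≥ λ n<2^20 → ¬q
    -- From ε ≤ 1 one has 1/ε² ≥ 1. Cuts being open, 56 and 1 are replaced by 55 and ½, whose
    -- product still exceeds 20.
    ( 20 , 0 , 0 , 2 ^ 20 , 0
    , inj₂ (frac 55 0 , frac 1 1 , frac-nonNeg 55 0 , frac-nonNeg 1 1
           , from-yes (frac 55 0 ℚ.<? frac 56 0)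
           , (1ℚ , 1ℚ , from-yes (0ℚ ℚ.<? 1ℚ) , ¬cut-ε²
             , from-yes (frac 1 1 ℚ.<? 1ℚ) , from-yes (1ℚ ℚ.* 1ℚ ℚ.≤? 1ℚ))
           , from-yes (frac 20 0 ℚ.<? frac 55 0 ℚ.* frac 1 1))
    , ℚ.<-trans q<n (frac-< n 0 (2 ^ 20) 0 (ℕ.*-monoˡ-< 1 {n} {2 ^ 20} n<2^20))
    , ℕ.≤-refl )
    where
    cut⇒≤1 : ∀ {p} → cut ε p → p ℚ.≤ 1ℚ
    cut⇒≤1 εp = ℚ.<⇒≤ (ε≤1 _ εp)
    ¬cut-ε² : ¬ cut (ε R.* ε) 1ℚ
    ¬cut-ε² (inj₁ 1<0) = ℚ.<-asym 1<0 (from-yes (0ℚ ℚ.<? 1ℚ))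
    ¬cut-ε² (inj₂ (q , r , 0≤q , 0≤r , εq , εr , 1<qr)) = ℚ.<-irrefl refl (ℚ.<-≤-trans 1<qr
      (ℚ.≤-trans (ℚ.*-monoˡ-≤-nonNeg q {{ℚ.nonNegative 0≤q}} (cut⇒≤1 εr))
        (ℚ.≤-trans (ℚ.≤-reflexive (ℚ.*-identityʳ q)) (cut⇒≤1 εq))))

  -- The conclusion is (a - d) / suc c ≤ ⅓ with denominators cleared. As `r` is at least ⅔, a larger
  -- exponent would push `q` above ⅓ + ⅔ = 1.
  exponent-≤⅓ : ∀ {ε} → ⅔ R.≤ ε → ∀ a d c → cut (fromℕ 1 R.- ε) ((a ⊖ d) ℚ./ suc c) →
                a * 3 ≤ suc c + d * 3
  exponent-≤⅓ ⅔≤ε a d c (q , r , q<1 , ¬εr , e+r<q) = ℕ.≮⇒≥ λ lt → ℚ.<-irrefl refl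
    (ℚ.<-trans (ℚ.≤-<-trans
      (ℚ.+-mono-≤ (frac-≤-⊖ 1 2 a d c (ℕ.≤-trans
                    (ℕ.≤-reflexive (cong (_+ d * 3) (ℕ.*-identityˡ _))) (ℕ.<⇒≤ lt)))
                  (ℚ.≮⇒≥ (λ r<⅔ → ¬εr (⅔≤ε r r<⅔))))
      e+r<q) q<1)

  -- As 1 - ε ≤ ⅓, the inner power is at most the cube root of `n`, hence below `1 + c`. The
  -- exponent is `2 + c` because the cut of `s` holds only rationals strictly below `s`:
  -- `2 ^ (2 + c) ≤ s` puts `2 ^ (1 + c)` into it.
  orbit-bound : ∀ {ε n s c} → .{{_ : NonZero n}} → ⅔ R.≤ ε →
                fromℕ s R.≤ 2 R.^ (n R.^ (fromℕ 1 R.- ε)) → n < suc c ^ 3 → s < 2 ^ (2 + c)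
  orbit-bound {ε} {n} {s} {c} ⅔≤ε s≤ n<k³ = ℕ.≰⇒> λ 2^d≤s → absurd
    (s≤ (frac (2 ^ k) 0) (frac-< (2 ^ k) 0 s 0 (ℕ.*-monoˡ-< 1
      (ℕ.<-≤-trans (ℕ.^-monoʳ-< 2 (s≤s (s≤s z≤n)) (ℕ.n<1+n k)) 2^d≤s))))
    where
    k = suc c
    absurd : ¬ cut (2 R.^ (n R.^ (fromℕ 1 R.- ε))) (frac (2 ^ k) 0)
    -- Both powers are unfolded: the first fraction forces its exponent to be at least `k`, the
    -- second exceeds that exponent and has cube at most `n`.
    absurd (a , d , C , u , v , (a′ , d′ , C′ , u′ , v′ , cut-e′ , e<u′/v′ , le′) , 2^k<u/v , le) =
      ℕ.<⇒≱ n<k³ (ℕ.*-cancelʳ-≤ (k ^ 3) n (suc v′ ^ 3) (begin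
        k ^ 3 * suc v′ ^ 3   ≡⟨ ^-distribʳ-* k (suc v′) 3 ⟨
        (k * suc v′) ^ 3     ≤⟨ ℕ.^-monoˡ-≤ 3 (ℕ.<⇒≤ kv′<u′) ⟩
        u′ ^ 3               ≤⟨ cube-≤ {n} {a′} {d′} {suc C′} {u′} {suc v′}
                                 (exponent-≤⅓ {ε} ⅔≤ε a′ d′ C′ cut-e′) le′ ⟩
        n * suc v′ ^ 3       ∎))
      where
      open ℕ.≤-Reasoning
      exponent : k * suc C + d ≤ a
      exponent = exponent-≥ {a} {d} {suc C} {k} {u} {suc v}
        (subst (2 ^ k * suc v <_) (ℕ.*-identityʳ u) (frac-<⁻¹ (2 ^ k) 0 u v 2^k<u/v)) le
      k≤e : frac k 0 ℚ.≤ (a ⊖ d) ℚ./ suc C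
      k≤e = frac-≤-⊖ k 0 a d C (subst₂ _≤_ (cong (_+_ (k * suc C)) (sym (ℕ.*-identityʳ d)))
                                           (sym (ℕ.*-identityʳ a)) exponent)
      kv′<u′ : k * suc v′ < u′
      kv′<u′ = subst (k * suc v′ <_) (ℕ.*-identityʳ u′)
        (frac-<⁻¹ k 0 u′ v′ (ℚ.≤-<-trans k≤e e<u′/v′))

  -- `a` and `b` are to be the integral parts of the logarithms of `s` and `n`. Rounding costs a
  -- factor two on either side, so the 3 becomes 12.
  log-ratio : ∀ {n s w a b} → 0 < b → n ^ w ≤ s ^ 3 → 2 ^ b ≤ n → s < 2 ^ suc a → 1 ≤ a →
              w * suc b ≤ 12 * a
  log-ratio {n} {s} {w} {a} {b} 0<b n^w≤s³ 2^b≤n s<2^a+1 1≤a = begin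
    w * suc b         ≤⟨ ℕ.*-monoʳ-≤ w (ℕ.+-monoˡ-≤ b 0<b) ⟩
    w * (b + b)       ≡⟨ identity₁ w b ⟩
    b * w * 2         ≤⟨ ℕ.*-monoˡ-≤ 2 (ℕ.<⇒≤ (2^-cancel-< (b * w) (suc a * 3) bits)) ⟩
    suc a * 3 * 2     ≤⟨ ℕ.*-monoˡ-≤ 2 (ℕ.*-monoˡ-≤ 3 (ℕ.+-monoˡ-≤ a 1≤a)) ⟩
    (a + a) * 3 * 2   ≡⟨ identity₂ a ⟩
    12 * a            ∎
    where
    open ℕ.≤-Reasoning
    bits : 2 ^ (b * w) < 2 ^ (suc a * 3)
    bits = begin-strict
      2 ^ (b * w)      ≡⟨ ℕ.^-*-assoc 2 b w ⟨
      (2 ^ b) ^ w      ≤⟨ ℕ.^-monoˡ-≤ w 2^b≤n ⟩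
      n ^ w            ≤⟨ n^w≤s³ ⟩
      s ^ 3            <⟨ ℕ.^-monoˡ-< 3 s<2^a+1 ⟩
      (2 ^ suc a) ^ 3  ≡⟨ ℕ.^-*-assoc 2 (suc a) 3 ⟩
      2 ^ (suc a * 3)  ∎
    identity₁ : ∀ w b → w * (b + b) ≡ b * w * 2
    identity₁ = solve-∀
    identity₂ : ∀ a → (a + a) * 3 * 2 ≡ 12 * a
    identity₂ = solve-∀

  log-quotient : ∀ {ε n s w} → .{{_ : NonZero n}} → .{{_ : NonZero s}} → (0<ε : 0ℝ R.< ε) →
    ε R.≤ fromℕ 1 → (1<n : 1 < n) → n ^ w ≤ s ^ 3 →
    fromℕ w R.≤ fromℕ 33 R./ ε [ 0<ε ] R.* (log s R./ log n [ log-pos {n} 1<n ])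
  log-quotient {w = zero} 0<ε ε≤1 1<n n^w≤s³ p p<0 = inj₁ p<0
  log-quotient {ε} {n} {s} {w@(suc w′)} 0<ε ε≤1 1<n n^w≤s³ p p<w with log-floor s | log-floor n
  -- Here `s` is at most 1, so `n ^ w ≤ s ^ 3` fails for positive `w`.
  ... | zero  , _ , s<2 | _ = contradiction n^w≤s³ (ℕ.<⇒≱ (ℕ.≤-<-trans
    (ℕ.^-monoˡ-≤ 3 (ℕ.≤-pred s<2)) (ℕ.<-≤-trans 1<n (ℕ.m≤m*n n (n ^ w′) {{ℕ.m^n≢0 n w′}}))))
  ... | suc a , _ , _   | zero , _ , n<2 = contradiction 1<n (ℕ.<⇒≱ n<2)
  ... | a@(suc a′) , 2^a≤s , s<2^a+1 | b@(suc _) , 2^b≤n , n<2^b+1 = inj₂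
    -- 15 lies below 33/ε, and 4a / (5(b + 1)) below the quotient of logarithms; their product 12a /
    -- (b + 1) is at least `w` by `log-ratio`.
    ( frac 15 0 , frac (4 * a) (b + 4 * suc b) , frac-nonNeg 15 0 , frac-nonNeg (4 * a) (b + 4 * suc b)
    , cut-33/ε , cut-log/log
    , ℚ.<-≤-trans p<w (subst (frac w 0 ℚ.≤_) (sym (frac-* 15 0 (4 * a) (b + 4 * suc b)))
        (frac-≤ w 0 (15 * (4 * a)) (b + 4 * suc b + 0) w-bound)) )
    where
    cut-33/ε : cut (fromℕ 33 R./ ε [ 0<ε ]) (frac 15 0)
    cut-33/ε = inj₂
      ( frac 32 0 , frac 1 1 , frac-nonNeg 32 0 , frac-nonNeg 1 1
      , from-yes (frac 32 0 ℚ.<? frac 33 0)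
      , (1ℚ , 1ℚ , from-yes (0ℚ ℚ.<? 1ℚ) , ¬cut-1 {ε} ε≤1
        , from-yes (frac 1 1 ℚ.<? 1ℚ) , from-yes (1ℚ ℚ.* 1ℚ ℚ.≤? 1ℚ))
      , from-yes (frac 15 0 ℚ.<? frac 32 0 ℚ.* frac 1 1))
    ¬cut-log-n : ¬ cut (log n) (frac (suc b) 0)
    ¬cut-log-n (e , c , b+1<e/c , 2^e≤n^c) = ℕ.<⇒≱ (begin-strict
      n ^ suc c              <⟨ ℕ.^-monoˡ-< (suc c) n<2^b+1 ⟩
      (2 ^ suc b) ^ suc c    ≡⟨ ℕ.^-*-assoc 2 (suc b) (suc c) ⟩
      2 ^ (suc b * suc c)    ≤⟨ ℕ.^-monoʳ-≤ 2 (ℕ.<⇒≤ (frac-<⁻¹ (suc b) 0 e c b+1<e/c)) ⟩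
      2 ^ (e * 1)            ≡⟨ cong (2 ^_) (ℕ.*-identityʳ e) ⟩
      2 ^ e                  ∎) 2^e≤n^c
      where open ℕ.≤-Reasoning
    D = b + 9 * suc b
    cut-log/log : cut (log s R./ log n [ log-pos {n} 1<n ]) (frac (4 * a) (b + 4 * suc b))
    cut-log/log = inj₂
      -- `a` and 1 / (b + 1) are each shrunk by 9/10 to land inside the open cuts; 81/100 still
      -- exceeds 4/5.
      ( frac (9 * a) 9 , frac 9 D , frac-nonNeg (9 * a) 9 , frac-nonNeg 9 D
      , (a , 0 , frac-< (9 * a) 9 a 0 below-a , ℕ.≤-trans 2^a≤s (ℕ.≤-reflexive (sym (ℕ.*-identityʳ s))))
      , (frac (suc b) 0 , frac 1 b , frac-< 0 0 (suc b) 0 (s≤s z≤n) , ¬cut-log-n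
        , frac-< 9 D 1 b (below-1/b b)
        , subst (ℚ._≤ 1ℚ) (sym (frac-* 1 b (suc b) 0))
            (frac-≤ (1 * suc b) (0 + b * 1) 1 0 (ℕ.≤-reflexive (reciprocal b))))
      , subst (frac (4 * a) (b + 4 * suc b) ℚ.<_) (sym (frac-* (9 * a) 9 9 D))
          (frac-< (4 * a) (b + 4 * suc b) (9 * a * 9) (D + 9 * suc D) (product a′ b)) )
      where
      reciprocal : ∀ b → 1 * suc b * 1 ≡ 1 * suc (0 + b * 1)
      reciprocal = solve-∀
      below-a : 9 * a * 1 < a * 10
      below-a = subst₂ _<_ (l a) (r a) (ℕ.m<m+n (9 * a) {a} (s≤s z≤n))
        where
        l : ∀ a → 9 * a ≡ 9 * a * 1
        l = solve-∀
        r : ∀ a → 9 * a + a ≡ a * 10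
        r = solve-∀
      below-1/b : ∀ b → 9 * suc b < 1 * suc (b + 9 * suc b)
      below-1/b b = subst (9 * suc b <_) (r b) (ℕ.m<m+n (9 * suc b) {suc b} (s≤s z≤n))
        where
        r : ∀ b → 9 * suc b + suc b ≡ 1 * suc (b + 9 * suc b)
        r = solve-∀
      product : ∀ a b → 4 * suc a * suc (b + 9 * suc b + 9 * suc (b + 9 * suc b)) <
                        9 * suc a * 9 * suc (b + 4 * suc b)
      product a b = subst₂ _<_ (l a b) (r a b)
        (ℕ.m<m+n (400 * (suc a * suc b)) {5 * (suc a * suc b)} (s≤s z≤n))
        where
        l : ∀ a b → 400 * (suc a * suc b) ≡
                    4 * suc a * suc (b + 9 * suc b + 9 * suc (b + 9 * suc b))
        l = solve-∀
        r : ∀ a b → 400 * (suc a * suc b) + 5 * (suc a * suc b) ≡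
                    9 * suc a * 9 * suc (b + 4 * suc b)
        r = solve-∀
    w-bound : w * suc (b + 4 * suc b + 0) ≤ 15 * (4 * a) * 1
    w-bound = subst₂ _≤_ (l w b) (r a)
      (ℕ.*-monoˡ-≤ 5 (log-ratio {n} {s} {w} {a} {b} (s≤s z≤n) n^w≤s³ 2^b≤n s<2^a+1 (s≤s z≤n)))
      where
      l : ∀ w b → w * suc b * 5 ≡ w * suc (b + 4 * suc b + 0)
      l = solve-∀
      r : ∀ a → 12 * a * 5 ≡ 15 * (4 * a) * 1
      r = solve-∀

  power-bound : ∀ {n d s w k} → .{{NonZero n}} → n ≤ d ^ 3 → w ≤ k → d ^ k ≤ s → n ^ w ≤ s ^ 3
  power-bound {n} {d} {s} {w} {k} n≤d³ w≤k d^k≤s = begin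
    n ^ w          ≤⟨ ℕ.^-monoʳ-≤ n w≤k ⟩
    n ^ k          ≤⟨ ℕ.^-monoˡ-≤ k n≤d³ ⟩
    (d ^ 3) ^ k    ≡⟨ ^-swap d 3 k ⟩
    (d ^ k) ^ 3    ≤⟨ ℕ.^-monoˡ-≤ 3 d^k≤s ⟩
    s ^ 3          ∎
    where open ℕ.≤-Reasoning

  -- `d = 2 + c` serves twice: `s < 2 ^ d` limits the families, and `n ≤ d ^ 3` turns `d ^ k ≤ s`
  -- into the claim, while quadratic terms in `d` still fit below `n`.
  SP-bound : ∀ {n} → .{{_ : NonZero n}} → 2 ^ 20 ≤ n → ∀ {𝔹 τ q} (C : R.Circuit 𝔹 τ q n) →
    R.Rigid C → (sym-C : R.Symmetric C) → ∀ {s} → R.MaxOrbit C sym-C s →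
    (∀ {c} → n < suc c ^ 3 → s < 2 ^ (2 + c)) → ∀ {w} → R.CircuitSP C sym-C w → n ^ w ≤ s ^ 3
  SP-bound {n} n-large C rigid sym-C s-max s-small w-max with cube-root n
  ... | c , c³≤n , n<[c+1]³ =
    let c-large = cube-root-large {n} {c} n-large n<[c+1]³
        _ , w≤k , d^k≤s = SP-norm-bound C rigid sym-C {d = 2 + c} s-max (s-small {c} n<[c+1]³)
                            (room₁ {n} {c} c-large c³≤n) (room₂ {n} {c} c-large c³≤n) w-max
    in power-bound {n} {2 + c}
         (ℕ.≤-trans (ℕ.<⇒≤ n<[c+1]³) (ℕ.^-monoˡ-≤ 3 (ℕ.n≤1+n (suc c)))) w≤k d^k≤s

-- The bound on supports in terms of real logarithms.

open import Data.Nat.Base using (ℕ; NonZero; >-nonZero)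
open import Data.Nat.Properties using (<-trans; 0<1+n)
open import Defs
open Estimates using (n-lower-bound; orbit-bound; SP-bound; log-quotient)

theorem21 :
  (ε : ℝ) (n : ℕ) (⅔≤ε : ⅔ ≤ ε) (ε≤1 : ε ≤ fromℕ 1) →
  let 0<ε  = ⅔≤⇒positive {ε} ⅔≤ε
      0<ε² = *-pos {ε} {ε} 0<ε 0<ε
  in
  (n-large : 2 ^ (fromℕ 56 / (ε * ε) [ 0<ε² ]) < fromℕ n) →
  let 1<n = 2^<⇒1< {n} {fromℕ 56 / (ε * ε) [ 0<ε² ]}
              (/-pos {fromℕ 56} {ε * ε} (fromℕ-pos 56) 0<ε²) n-large
      instance
        n≢0 : NonZero n
        n≢0 = >-nonZero (<-trans 0<1+n 1<n)
  in
  (𝔹 : Basis) (τ : Vocabulary) (q : ℕ) (C : Circuit 𝔹 τ q n) →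
  Rigid C → (sym-C : Symmetric C) →
  (s : ℕ) (s-max : MaxOrbit C sym-C s) →
  fromℕ s ≤ 2 ^ (n ^ (fromℕ 1 - ε)) →
  (w : ℕ) → CircuitSP C sym-C w →
  let instance
        s≢0 : NonZero s
        s≢0 = MaxOrbit-nonZero C sym-C s-max
  in
  fromℕ w ≤ fromℕ 33 / ε [ 0<ε ] * (log s / log n [ log-pos {n} 1<n ])
theorem21 ε n ⅔≤ε ε≤1 n-large 𝔹 τ q C rigid sym-C s s-max s≤ w w-max =
  log-quotient {ε} {n} {s} {w} 0<ε ε≤1 1<n
    (SP-bound (n-lower-bound {ε} {n} 0<ε² ε≤1 n-large) C rigid sym-C s-max
      (λ {c} → orbit-bound {ε} {n} {s} {c} ⅔≤ε s≤) w-max)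
  where
  0<ε  = ⅔≤⇒positive {ε} ⅔≤ε
  0<ε² = *-pos {ε} {ε} 0<ε 0<ε
  1<n  = 2^<⇒1< {n} {fromℕ 56 / (ε * ε) [ 0<ε² ]}
           (/-pos {fromℕ 56} {ε * ε} (fromℕ-pos 56) 0<ε²) n-large
  instance
    n≢0 : NonZero n
    n≢0 = >-nonZero (<-trans 0<1+n 1<n)
    s≢0 : NonZero s
    s≢0 = MaxOrbit-nonZero C sym-C s-max
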